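{- Let $p\geq 2$ be an integer and let $\sigma$ be the substitution on $\{ -1,1\}$ given by $\sigma(1)=v_0v_1\cdots v_{p-1}$, $\sigma(-1)=w_0w_1\cdots w_{p-1}$, where $v_i,w_i\in\{ -1,1\}$ and $v_0=1$. Let $\mathbf{d}=d_0d_1d_2\cdots=\lim_{n\to\infty}\sigma^n(1)$ and $f(z)=\sum_{n\geq 0}d_nz^n$. If $\mathbf{d}$ is apwenian, then \[f(z)=\prod_{i=0}^{\infty}P(z^{p^i}),\qquad P(z)=v_0+v_1z+\cdots+v_{p-1}z^{p-1}.\]
   Context: Substitutions are extended to words by concatenation, and the limit is taken in the product topology on infinite words (the fixed point of $\sigma$ starting with $1$). For an integer sequence $\mathbf{a}$, $H_n(\mathbf{a})=\det(a_{i+j})_{0\leq i,j\leq n-1}$. A sequence $\mathbf{d}\in\{ -1,1\}^{\infty}$ is apwenian if $H_n(\mathbf{d})/2^{n-1}\equiv 1\pmod 2$ for all $n\geq 1$. -}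

module Defs where

open import Data.Nat as ℕ using (ℕ; zero; suc; _≤_; _^_; _∸_; _≡ᵇ_)
open import Data.Integer as ℤ using (ℤ; +_; -_; _+_; _*_)
open import Data.Fin using (Fin; toℕ; punchIn) renaming (zero to fzero; suc to fsuc)
open import Data.List using (List; []; _∷_; concatMap; tabulate)
open import Data.Maybe using (Maybe; just; nothing)
open import Data.Bool using (if_then_else_)
open import Data.Product using (∃)
open import Data.Sum using (_⊎_)
open import Relation.Binary.PropositionalEquality using (_≡_)
open import Relation.Nullary using (yes; no)

-- the alphabet {-1,1} is represented inside ℤ
IsPM : ℤ → Set
IsPM x = x ≡ + 1 ⊎ x ≡ - (+ 1)

σ : {p : ℕ} → (Fin p → ℤ) → (Fin p → ℤ) → ℤ → List ℤ
σ v w x with x ℤ.≟ + 1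
... | yes _ = tabulate v
... | no  _ = tabulate w

σ* : {p : ℕ} → (Fin p → ℤ) → (Fin p → ℤ) → List ℤ → List ℤ
σ* v w = concatMap (σ v w)

σIter : {p : ℕ} → (Fin p → ℤ) → (Fin p → ℤ) → ℕ → List ℤ
σIter v w zero    = + 1 ∷ []
σIter v w (suc n) = σ* v w (σIter v w n)

nth : {A : Set} → List A → ℕ → Maybe A
nth []       _       = nothing
nth (x ∷ xs) zero    = just x
nth (x ∷ xs) (suc m) = nth xs m

-- d = lim σⁿ(1) in the product topology: every letter eventually stabilises
IsLimitFixedPoint : {p : ℕ} → (Fin p → ℤ) → (Fin p → ℤ) → (ℕ → ℤ) → Set
IsLimitFixedPoint v w d =
  ∀ m → ∃ λ N → ∀ n → N ≤ n → nth (σIter v w n) m ≡ just (d m)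

ΣFin : (n : ℕ) → (Fin n → ℤ) → ℤ
ΣFin zero    f = + 0
ΣFin (suc n) f = f fzero + ΣFin n (λ i → f (fsuc i))

sgn : ℕ → ℤ
sgn zero    = + 1
sgn (suc k) = - sgn k

det : (n : ℕ) → (Fin n → Fin n → ℤ) → ℤ
det zero    M = + 1
det (suc n) M =
  ΣFin (suc n) (λ j → sgn (toℕ j) * M fzero j * det n (λ i k → M (fsuc i) (punchIn j k)))

Hankel : ℕ → (ℕ → ℤ) → ℤ
Hankel n a = det n (λ i j → a (toℕ i ℕ.+ toℕ j))

-- apwenian: H_n(d) / 2^{n-1} ≡ 1 (mod 2) for all n ≥ 1,
-- i.e. H_n(d) = 2^{n-1} · (odd integer)
Apwenian : (ℕ → ℤ) → Set
Apwenian d = ∀ n → 1 ≤ n → ∃ λ k → Hankel n d ≡ (+ (2 ^ (n ∸ 1))) * (+ 1 + (+ 2) * k)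

Series : Set
Series = ℕ → ℤ

sumTo : ℕ → (ℕ → ℤ) → ℤ
sumTo zero    f = f zero
sumTo (suc n) f = sumTo n f + f (suc n)

_⊛_ : Series → Series → Series
(a ⊛ b) n = sumTo n (λ k → a k * b (n ∸ k))

oneS : Series
oneS zero    = + 1
oneS (suc _) = + 0

-- P(z^m) where P(z) = v₀ + v₁ z + … + v_{p-1} z^{p-1}
PAt : {p : ℕ} → (Fin p → ℤ) → ℕ → Series
PAt {p} v m n = ΣFin p (λ j → if n ≡ᵇ (toℕ j ℕ.* m) then v j else + 0)

partialProd : {p : ℕ} → (Fin p → ℤ) → ℕ → Series
partialProd v zero    = oneS
partialProd {p} v (suc K) = partialProd v K ⊛ PAt v (p ^ K)

-- f = ∏_{i≥0} P(z^{p^i}) in ℤ[[z]]: the partial products converge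
-- coefficientwise (z-adic topology) to f
EqInfiniteProduct : {p : ℕ} → (Fin p → ℤ) → Series → Set
EqInfiniteProduct v f = ∀ n → ∃ λ K → ∀ K′ → K ≤ K′ → partialProd v K′ n ≡ f n

{-# OPTIONS --safe #-}
module Submission where

-- Write d n = (-1)^(c n) with c n ∈ 𝔽₂.  Taking differences of consecutive rows, and then of
-- consecutive columns, of the Hankel matrices shows that, if d is apwenian, no Hankel
-- determinant of g n = c n + c (n + 2) vanishes over 𝔽₂.  The functional L : zⁿ ↦ g n then has
-- orthogonal polynomials of every degree, and evaluating R ↦ L((z² + z) R² + R), which is
-- additive in characteristic 2, on them gives g (2n + 2) + g (2n + 1) + g n = 0 and g 0 = 1,
-- that is, c n + c (n + 1) + c (2n + 1) + c (2n + 2) = 1.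
-- On the other hand c (i + n p) = vᵢ + δᵢ c n, where δᵢ = vᵢ + wᵢ in 𝔽₂.  Inserting this into the
-- relation forces δᵢ = 1 for all i; so w = -v, d (i + n p) = d n · vᵢ, and f(z) = P(z) f(zᵖ).

open import Defs
open import Data.Nat as ℕ using (ℕ; zero; suc; _≤_; _<_; z≤n; s≤s; _∸_; _^_)
import Data.Nat.Properties as ℕₚ
open import Data.Nat.DivMod using (_/_; _%_; m≡m%n+[m/n]*n; m%n<n; m<n⇒m%n≡m; [m+kn]%n≡m%n; m<n*o⇒m/o<n; m*n/n≡m; /-monoˡ-≤)
import Data.Nat.Tactic.RingSolver as ℕSolver
open import Data.Integer as ℤ using (ℤ; +_; -_; _+_; _*_; _-_; -[1+_])
import Data.Integer.Properties as ℤₚ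
open import Data.Integer.Tactic.RingSolver using (solve-∀)
open import Data.Fin using (Fin; toℕ; punchIn; fromℕ<) renaming (zero to fzero; suc to fsuc)
import Data.Fin.Properties as Finₚ
open import Data.Product using (∃; _×_; _,_; proj₁; proj₂)
open import Data.Sum using (_⊎_; inj₁; inj₂)
open import Data.Empty using (⊥; ⊥-elim)
open import Data.Bool using (Bool; true; false; _xor_; _∧_; if_then_else_)
open import Data.Bool.Solver using (module xor-∧-Solver)
open xor-∧-Solver using (_:+_; _:*_; _:=_; con) renaming (solve to solve₂)
open import Data.List using (List; []; _∷_; _++_; length; tabulate)
open import Data.Maybe using (just)
open import Data.Maybe.Properties using (just-injective)
open import Function using (_∘_)
open import Relation.Binary.PropositionalEquality
open import Relation.Binary.Definitions using (tri<; tri≈; tri>)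
open import Relation.Nullary using (yes; no; ¬_)
open import Relation.Nullary.Decidable using (dec-true; dec-false)

-- Why `c (n + 2)` occurs: row differences split the power of 2 off the Hankel determinant and leave
-- one row of odd entries above rows formed from e n = c n + c (n + 1). Modulo 2 the odd row is
-- constant, so column differences clear it up to one entry and turn e n into e n + e (n + 1) = g n.
-- No determinant over 𝔽₂ is formed. Degeneracy of g means here that some monic q of degree n
-- satisfies L(zⁱ q) = 0 for all i ≤ n; such a q yields an integral combination of rows divisible by
-- 2. Over 𝔽₂ a nonzero norm is 1, so the three-term recurrence is z q = q⁺ + b q + r with a single
-- unknown b, and b cancels between L(z² q²) and L(z q²). The obstacle for δ is the carry in i ↦ 2i
-- + 1, 2i + 2: when 2i + 2 = p the doubled pair straddles two blocks, and the chain of equalities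
-- δᵢ = δᵢ₊₁ breaks there. Hence both ends δ₀ and δₚ₋₁ are determined separately. Wherever the
-- argument could fail, c (2n + 1) = c n + κ results, and so rigid a sequence makes δ constant
-- anyway.

-- Determinants as alternating multilinear functions of the rows

ΣFin-cong : ∀ n {f g : Fin n → ℤ} → (∀ i → f i ≡ g i) → ΣFin n f ≡ ΣFin n g
ΣFin-cong zero    eq = refl
ΣFin-cong (suc n) eq = cong₂ _+_ (eq fzero) (ΣFin-cong n (λ i → eq (fsuc i)))

ΣFin-linear : ∀ n (f g : Fin n → ℤ) c →
  ΣFin n (λ i → f i + c * g i) ≡ ΣFin n f + c * ΣFin n g
ΣFin-linear zero    f g c = sym (trans (ℤₚ.+-identityˡ _) (ℤₚ.*-zeroʳ c))
ΣFin-linear (suc n) f g c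
  rewrite ΣFin-linear n (λ i → f (fsuc i)) (λ i → g (fsuc i)) c =
    lemma (f fzero) (g fzero) c _ _
  where
  lemma : ∀ x y c s t → x + c * y + (s + c * t) ≡ x + s + c * (y + t)
  lemma = solve-∀

ΣFin-zero : ∀ n {f : Fin n → ℤ} → (∀ i → f i ≡ + 0) → ΣFin n f ≡ + 0
ΣFin-zero zero    eq = refl
ΣFin-zero (suc n) eq rewrite eq fzero = trans (ℤₚ.+-identityˡ _) (ΣFin-zero n (λ i → eq (fsuc i)))

-- Rows are indexed by ℕ (only the first n of them matter to D n), columns by Fin.
Rows : ℕ → Set
Rows N = ℕ → Fin N → ℤ

D : ∀ n → Rows n → ℤ
D n F = det n (λ i → F (toℕ i))

minor : ∀ {n} → Fin (suc n) → Rows (suc n) → Rows n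
minor j F i k = F (suc i) (punchIn j k)

laplace : ∀ {n} → Rows (suc n) → Fin (suc n) → ℤ
laplace {n} F j = sgn (toℕ j) * F 0 j * D n (minor j F)

D-cong : ∀ n {F G : Rows n} → (∀ i → i < n → ∀ j → F i j ≡ G i j) → D n F ≡ D n G
D-cong zero    eq = refl
D-cong (suc n) eq = ΣFin-cong (suc n) λ j →
  cong₂ (λ x y → sgn (toℕ j) * x * y) (eq 0 (s≤s z≤n) j)
    (D-cong n (λ i i<n k → eq (suc i) (s≤s i<n) (punchIn j k)))

D-linear : ∀ n k → k < n → (F A B : Rows n) (c : ℤ) →
  (∀ i → i ≢ k → ∀ j → F i j ≡ A i j) → (∀ i → i ≢ k → ∀ j → F i j ≡ B i j) →
  (∀ j → F k j ≡ A k j + c * B k j) → D n F ≡ D n A + c * D n B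
D-linear (suc n) zero _ F A B c fa fb eq =
  trans (ΣFin-cong (suc n) term) (ΣFin-linear (suc n) (laplace A) (laplace B) c)
  where
  lemma : ∀ s a b c m → s * (a + c * b) * m ≡ s * a * m + c * (s * b * m)
  lemma = solve-∀
  term : ∀ j → laplace F j ≡ laplace A j + c * laplace B j
  term j rewrite eq j
    | sym (D-cong n {minor j F} {minor j A} (λ i _ k → fa (suc i) (λ ()) (punchIn j k)))
    | sym (D-cong n {minor j F} {minor j B} (λ i _ k → fb (suc i) (λ ()) (punchIn j k))) =
      lemma (sgn (toℕ j)) (A 0 j) (B 0 j) c _
D-linear (suc n) (suc k) (s≤s k<n) F A B c fa fb eq =
  trans (ΣFin-cong (suc n) term) (ΣFin-linear (suc n) (laplace A) (laplace B) c)
  where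
  lemma : ∀ s x c a b → s * x * (a + c * b) ≡ s * x * a + c * (s * x * b)
  lemma = solve-∀
  term : ∀ j → laplace F j ≡ laplace A j + c * laplace B j
  term j rewrite sym (fa 0 (λ ()) j) | sym (fb 0 (λ ()) j)
    | D-linear n k k<n (minor j F) (minor j A) (minor j B) c
        (λ i i≢k l → fa (suc i) (λ e → i≢k (ℕₚ.suc-injective e)) (punchIn j l))
        (λ i i≢k l → fb (suc i) (λ e → i≢k (ℕₚ.suc-injective e)) (punchIn j l))
        (λ l → eq (punchIn j l)) =
      lemma (sgn (toℕ j)) (F 0 j) c _ _

-- The double Laplace expansion along two equal rows.  The terms with j = 0 cancel against
-- those with k = 0, and the others form an expansion of the same shape, one size smaller.
doubleLaplace-zero : ∀ n (a : Fin (2 ℕ.+ n) → ℤ) (φ : (Fin n → Fin (2 ℕ.+ n)) → ℤ) →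
  (∀ f g → (∀ l → f l ≡ g l) → φ f ≡ φ g) →
  ΣFin (2 ℕ.+ n) (λ j → sgn (toℕ j) * a j *
    ΣFin (1 ℕ.+ n) (λ k → sgn (toℕ k) * a (punchIn j k) *
      φ (λ l → punchIn j (punchIn k l)))) ≡ + 0
doubleLaplace-zero n a φ φ-ext = begin
  + 1 * a₀ * S₁ + ΣFin (suc n) (λ j → - s j * a′ j * (+ 1 * a₀ * ψ j + T j))
    ≡⟨ cong (λ x → + 1 * a₀ * S₁ + x) (trans (ΣFin-cong (suc n) (λ j → split (s j) (a′ j) a₀ (ψ j) (T j)))
         (ΣFin-linear (suc n) (λ j → - s j * a′ j * T j) (λ j → s j * a′ j * ψ j) (- a₀))) ⟩
  + 1 * a₀ * S₁ + (ΣFin (suc n) (λ j → - s j * a′ j * T j) + - a₀ * S₁)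
    ≡⟨ cancel a₀ S₁ _ ⟩
  ΣFin (suc n) (λ j → - s j * a′ j * T j)
    ≡⟨ rest n a φ φ-ext ⟩
  + 0 ∎
  where
  open ≡-Reasoning
  a₀ = a fzero
  a′ : Fin (suc n) → ℤ
  a′ j = a (fsuc j)
  s : Fin (suc n) → ℤ
  s j = sgn (toℕ j)
  ψ : Fin (suc n) → ℤ
  ψ j = φ (λ l → fsuc (punchIn j l))
  S₁ = ΣFin (suc n) (λ k → s k * a′ k * ψ k)
  T : Fin (suc n) → ℤ
  T j = ΣFin n (λ k → - sgn (toℕ k) * a (fsuc (punchIn j k)) *
      φ (λ l → punchIn (fsuc j) (punchIn (fsuc k) l)))
  split : ∀ s x y p t → - s * x * (+ 1 * y * p + t) ≡ - s * x * t + - y * (s * x * p)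
  split = solve-∀
  cancel : ∀ x y z → + 1 * x * y + (z + - x * y) ≡ z
  cancel = solve-∀
  rest : ∀ n (a : Fin (2 ℕ.+ n) → ℤ) (φ : (Fin n → Fin (2 ℕ.+ n)) → ℤ) →
    (∀ f g → (∀ l → f l ≡ g l) → φ f ≡ φ g) →
    ΣFin (suc n) (λ j → - sgn (toℕ j) * a (fsuc j) *
      ΣFin n (λ k → - sgn (toℕ k) * a (fsuc (punchIn j k)) *
        φ (λ l → punchIn (fsuc j) (punchIn (fsuc k) l)))) ≡ + 0
  rest zero    a φ φ-ext = ΣFin-zero 1 (λ j → ℤₚ.*-zeroʳ (- sgn (toℕ j) * a (fsuc j)))
  rest (suc n) a φ φ-ext = trans (ΣFin-cong (2 ℕ.+ n) outer)
    (doubleLaplace-zero n (λ j → a (fsuc j)) (λ f → φ (lift f)) λ f g eq → φ-ext _ _ (lift-cong f g eq))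
    where
    lift : (Fin n → Fin (2 ℕ.+ n)) → Fin (suc n) → Fin (3 ℕ.+ n)
    lift f fzero    = fzero
    lift f (fsuc l) = fsuc (f l)
    lift-cong : ∀ f g → (∀ l → f l ≡ g l) → ∀ l → lift f l ≡ lift g l
    lift-cong f g eq fzero    = refl
    lift-cong f g eq (fsuc l) = cong fsuc (eq l)
    lift-punch : ∀ j k l → punchIn (fsuc j) (punchIn (fsuc k) l) ≡ lift (λ l → punchIn j (punchIn k l)) l
    lift-punch j k fzero    = refl
    lift-punch j k (fsuc l) = refl
    neg : ∀ s x y → - s * x * (+ 0 + - (+ 1) * y) ≡ s * x * y
    neg = solve-∀
    sgn-neg : ∀ s x p → - s * x * p ≡ + 0 + - (+ 1) * (s * x * p)
    sgn-neg = solve-∀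
    inner : ∀ j k → - sgn (toℕ k) * a (fsuc (punchIn j k)) *
        φ (λ l → punchIn (fsuc j) (punchIn (fsuc k) l)) ≡
      + 0 + - (+ 1) * (sgn (toℕ k) * a (fsuc (punchIn j k)) * φ (lift (λ l → punchIn j (punchIn k l))))
    inner j k rewrite φ-ext _ _ (lift-punch j k) = sgn-neg (sgn (toℕ k)) _ _
    outer : ∀ j → - sgn (toℕ j) * a (fsuc j) *
      ΣFin (suc n) (λ k → - sgn (toℕ k) * a (fsuc (punchIn j k)) *
        φ (λ l → punchIn (fsuc j) (punchIn (fsuc k) l))) ≡
      sgn (toℕ j) * a (fsuc j) * ΣFin (suc n) (λ k → sgn (toℕ k) * a (fsuc (punchIn j k)) *
        φ (lift (λ l → punchIn j (punchIn k l))))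
    outer j rewrite ΣFin-cong (suc n) (inner j)
      | ΣFin-linear (suc n) (λ _ → + 0) (λ k → sgn (toℕ k) * a (fsuc (punchIn j k)) *
          φ (lift (λ l → punchIn j (punchIn k l)))) (- (+ 1))
      | ΣFin-zero (suc n) {λ _ → + 0} (λ _ → refl) = neg (sgn (toℕ j)) _ _

-- Expanding along the first row lowers `k` until the equal rows are 0 and 1; there the expansion
-- along both rows vanishes.
D-adjacent : ∀ n k → suc k < n → (F : Rows n) → (∀ j → F k j ≡ F (suc k) j) → D n F ≡ + 0
D-adjacent (suc (suc n)) zero _ F eq =
  trans (ΣFin-cong (2 ℕ.+ n) λ j → cong (λ x → sgn (toℕ j) * F 0 j * x) (ΣFin-cong (suc n) λ k →
      cong (λ x → sgn (toℕ k) * x * D n (minor k (minor j F))) (sym (eq (punchIn j k)))))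
    (doubleLaplace-zero n (F 0) (λ f → D n (λ i l → F (2 ℕ.+ i) (f l)))
      (λ f g eq → D-cong n (λ i _ l → cong (F (2 ℕ.+ i)) (eq l))))
D-adjacent (suc zero) _ (s≤s ()) F eq
D-adjacent (suc (suc n)) (suc k) (s≤s k<n) F eq = ΣFin-zero (2 ℕ.+ n) λ j →
  trans (cong (λ x → sgn (toℕ j) * F 0 j * x) (D-adjacent (suc n) k k<n (minor j F) (λ l → eq (punchIn j l))))
    (ℤₚ.*-zeroʳ (sgn (toℕ j) * F 0 j))

upd : ∀ {N} → Rows N → ℕ → (Fin N → ℤ) → Rows N
upd F zero    X zero    = X
upd F zero    X (suc i) = F (suc i)
upd F (suc k) X zero    = F 0
upd F (suc k) X (suc i) = upd (λ i → F (suc i)) k X i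

upd-same : ∀ {N} (F : Rows N) k X → upd F k X k ≡ X
upd-same F zero    X = refl
upd-same F (suc k) X = upd-same (λ i → F (suc i)) k X

upd-other : ∀ {N} (F : Rows N) k X i → i ≢ k → upd F k X i ≡ F i
upd-other F zero    X zero    i≢k = ⊥-elim (i≢k refl)
upd-other F zero    X (suc i) i≢k = refl
upd-other F (suc k) X zero    i≢k = refl
upd-other F (suc k) X (suc i) i≢k = upd-other (λ i → F (suc i)) k X i (λ e → i≢k (cong suc e))

upd-self : ∀ {N} (F : Rows N) k i → upd F k (F k) i ≡ F i
upd-self F zero    zero    = refl
upd-self F zero    (suc i) = refl
upd-self F (suc k) zero    = refl
upd-self F (suc k) (suc i) = upd-self (λ i → F (suc i)) k i

D-upd-linear : ∀ n k → k < n → (F : Rows n) (X Y : Fin n → ℤ) (c : ℤ) →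
  D n (upd F k (λ j → X j + c * Y j)) ≡ D n (upd F k X) + c * D n (upd F k Y)
D-upd-linear n k k<n F X Y c = D-linear n k k<n _ _ _ c
  (λ i i≢k j → cong (λ r → r j) (trans (upd-other F k _ i i≢k) (sym (upd-other F k X i i≢k))))
  (λ i i≢k j → cong (λ r → r j) (trans (upd-other F k _ i i≢k) (sym (upd-other F k Y i i≢k))))
  (λ j → trans (cong (λ r → r j) (upd-same F k _))
    (cong₂ (λ r s → r j + c * s j) (sym (upd-same F k X)) (sym (upd-same F k Y))))

-- Polarisation: with b + a in both rows `k` and `k + 1` the determinant is 0, so exchanging these
-- rows only changes the sign. This brings the repeated row one step closer to row `i`; `m` counts
-- the rows in between.
D-alternating : ∀ n i m → suc (m ℕ.+ i) < n → (F : Rows n) →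
  (∀ j → F i j ≡ F (suc (m ℕ.+ i)) j) → D n F ≡ + 0
D-alternating n i zero    lt F eq = D-adjacent n i lt F eq
D-alternating n i (suc m) lt F eq = begin
  D n F                       ≡⟨ D-cong n (λ r _ j → cong (λ f → f j) (sym (U-self r))) ⟩
  D n (U b a)                 ≡⟨ solve₄ (D n (U b a)) _ _ _ expand (U-adjacent (b ⊞ a))
                                   (U-adjacent b) (U-adjacent a) moved ⟩
  + 0                         ∎
  where
  open ≡-Reasoning
  k = suc (m ℕ.+ i)
  a = F (suc k)
  b = F k
  k<n = ℕₚ.<-trans (ℕₚ.n<1+n k) lt
  U : (Fin n → ℤ) → (Fin n → ℤ) → Rows n
  U X Y = upd (upd F k X) (suc k) Y
  U-self : ∀ r → U b a r ≡ F r
  U-self r with r ℕ.≟ suc k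
  ... | yes refl = upd-same (upd F k b) (suc k) a
  ... | no  r≢   = trans (upd-other (upd F k b) (suc k) a r r≢) (upd-self F k r)
  U-k : ∀ X Y → U X Y k ≡ X
  U-k X Y = trans (upd-other (upd F k X) (suc k) Y k (ℕₚ.<⇒≢ (ℕₚ.n<1+n k))) (upd-same F k X)
  U-rows : ∀ X j → U X X k j ≡ U X X (suc k) j
  U-rows X j = cong (λ f → f j) (trans (U-k X X) (sym (upd-same (upd F k X) (suc k) X)))
  U-adjacent : ∀ X → D n (U X X) ≡ + 0
  U-adjacent X = D-adjacent n k lt (U X X) (U-rows X)
  _⊞_ : (Fin n → ℤ) → (Fin n → ℤ) → Fin n → ℤ
  (X ⊞ Y) j = X j + + 1 * Y j
  swap : ∀ X Y r → U X Y r ≡ upd (upd F (suc k) Y) k X r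
  swap X Y r with r ℕ.≟ suc k | r ℕ.≟ k
  ... | yes refl | _ = trans (upd-same (upd F k X) (suc k) Y)
        (sym (trans (upd-other (upd F (suc k) Y) k X (suc k) ℕₚ.1+n≢n) (upd-same F (suc k) Y)))
  ... | no r≢ | yes refl = trans (U-k X Y) (sym (upd-same (upd F (suc k) Y) k X))
  ... | no r≢ | no r≢k = trans (trans (upd-other _ (suc k) Y r r≢) (upd-other F k X r r≢k))
        (sym (trans (upd-other _ k X r r≢k) (upd-other F (suc k) Y r r≢)))
  U-swap : ∀ X Y → D n (U X Y) ≡ D n (upd (upd F (suc k) Y) k X)
  U-swap X Y = D-cong n (λ r _ j → cong (λ f → f j) (swap X Y r))
  linearˡ : ∀ X X′ Y → D n (U (X ⊞ X′) Y) ≡ D n (U X Y) + + 1 * D n (U X′ Y)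
  linearˡ X X′ Y = trans (U-swap _ Y) (trans (D-upd-linear n k k<n _ X X′ (+ 1))
    (cong₂ (λ x y → x + + 1 * y) (sym (U-swap X Y)) (sym (U-swap X′ Y))))
  expand : D n (U (b ⊞ a) (b ⊞ a)) ≡
    (D n (U b b) + + 1 * D n (U b a)) + + 1 * (D n (U a b) + + 1 * D n (U a a))
  expand = trans (linearˡ b a (b ⊞ a)) (cong₂ (λ x y → x + + 1 * y)
    (D-upd-linear n (suc k) lt (upd F k b) b a (+ 1)) (D-upd-linear n (suc k) lt (upd F k a) b a (+ 1)))
  moved : D n (U a b) ≡ + 0
  moved = D-alternating n i m k<n (U a b) λ j → trans
    (cong (λ f → f j) (trans (upd-other _ (suc k) b i (ℕₚ.<⇒≢ (s≤s (ℕₚ.m≤n+m i (suc m)))))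
      (upd-other F k a i (ℕₚ.<⇒≢ (s≤s (ℕₚ.m≤n+m i m))))))
    (trans (eq j) (cong (λ f → f j) (sym (U-k a b))))
  solve₄ : ∀ x y z t {u} → u ≡ (y + + 1 * x) + + 1 * (z + + 1 * t) → u ≡ + 0 → y ≡ + 0 → t ≡ + 0 → z ≡ + 0 → x ≡ + 0
  solve₄ x _ _ _ e refl refl refl refl = trans (simp x) (sym e)
    where
    simp : ∀ x → x ≡ (+ 0 + + 1 * x) + + 1 * (+ 0 + + 1 * + 0)
    simp = solve-∀

-- Linear functionals on 𝔽₂[z]

-- Polynomials over 𝔽₂ are lists of coefficients, constant term first.
Poly : Set
Poly = List Bool

-- The linear functional with moments zᵏ ↦ `μ k`; multiplication by z becomes a shift of `μ`.
L : (ℕ → Bool) → Poly → Bool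
L μ []      = false
L μ (a ∷ q) = (a ∧ μ 0) xor L (λ k → μ (suc k)) q

-- Such a list ends in `true`, so its length is the degree plus one.
data Monic : ℕ → Poly → Set where
  one  : Monic 0 (true ∷ [])
  cons : ∀ {n q} a → Monic n q → Monic (suc n) (a ∷ q)

L-cong : ∀ {μ ν : ℕ → Bool} → (∀ k → μ k ≡ ν k) → ∀ q → L μ q ≡ L ν q
L-cong eq []      = refl
L-cong eq (a ∷ q) = cong₂ (λ x y → (a ∧ x) xor y) (eq 0) (L-cong (λ k → eq (suc k)) q)

L-xor : ∀ (μ ν : ℕ → Bool) q → L (λ k → μ k xor ν k) q ≡ L μ q xor L ν q
L-xor μ ν []      = refl
L-xor μ ν (a ∷ q) rewrite L-xor (λ k → μ (suc k)) (λ k → ν (suc k)) q =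
  solve₂ 5 (λ a x y s t → a :* (x :+ y) :+ (s :+ t) := (a :* x :+ s) :+ (a :* y :+ t)) refl a (μ 0) (ν 0) _ _

-- Residues of integers modulo 2

ι : Bool → ℤ
ι false = + 0
ι true  = + 1

Parity : ℤ → Bool → Set
Parity x b = ∃ λ k → x ≡ ι b + + 2 * k

parity-+ : ∀ {x y} a b → Parity x a → Parity y b → Parity (x + y) (a xor b)
parity-+ false b     (k , refl) (l , refl) = k + l , lemma (ι b) k l
  where
  lemma : ∀ b k l → + 0 + + 2 * k + (b + + 2 * l) ≡ b + + 2 * (k + l)
  lemma = solve-∀
parity-+ true  false (k , refl) (l , refl) = k + l , lemma k l
  where
  lemma : ∀ k l → + 1 + + 2 * k + (+ 0 + + 2 * l) ≡ + 1 + + 2 * (k + l)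
  lemma = solve-∀
parity-+ true  true  (k , refl) (l , refl) = + 1 + k + l , lemma k l
  where
  lemma : ∀ k l → + 1 + + 2 * k + (+ 1 + + 2 * l) ≡ + 0 + + 2 * (+ 1 + k + l)
  lemma = solve-∀

parity-neg : ∀ {x} b → Parity x b → Parity (- x) b
parity-neg b (k , refl) = - ι b - k , lemma (ι b) k
  where
  lemma : ∀ b k → - (b + + 2 * k) ≡ b + + 2 * (- b - k)
  lemma = solve-∀

parity-ι : ∀ b → Parity (ι b) b
parity-ι b = + 0 , sym (ℤₚ.+-identityʳ (ι b))

parity-ι* : ∀ {x} a b → Parity x b → Parity (ι a * x) (a ∧ b)
parity-ι* {x} false b _       = + 0 , ℤₚ.*-zeroˡ x
parity-ι* {x} true  b (k , e) = k , trans (ℤₚ.*-identityˡ x) e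

odd≢even : ∀ k l → ¬ (+ 1 + + 2 * k ≡ + 2 * l)
odd≢even k l e = one≢two (l - k) (trans (lemma₁ k) (trans (cong (_- + 2 * k) e) (lemma₂ k l)))
  where
  lemma₁ : ∀ k → + 1 ≡ + 1 + + 2 * k - + 2 * k
  lemma₁ = solve-∀
  lemma₂ : ∀ k l → + 2 * l - + 2 * k ≡ + 2 * (l - k)
  lemma₂ = solve-∀
  one≢two : ∀ m → ¬ (+ 1 ≡ + 2 * m)
  one≢two (+ zero)         ()
  one≢two (+ suc m)        e with trans e (sym (ℤₚ.pos-* 2 (suc m)))
  ... | e′ rewrite ℕₚ.+-suc m (m ℕ.+ 0) with ℤₚ.+-injective e′
  ... | ()
  one≢two (ℤ.-[1+ m ])     ()

-- Parity of Hankel determinants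

-- hyb R E k has the rows R 0 , … , R k , E k , E (k + 1) , …
hyb : ∀ {N} → Rows N → Rows N → ℕ → Rows N
hyb R E k       zero    = R 0
hyb R E zero    (suc i) = E i
hyb R E (suc k) (suc i) = hyb (λ i → R (suc i)) (λ i → E (suc i)) k i

hyb-≤ : ∀ {N} (R E : Rows N) k i → i ≤ k → hyb R E k i ≡ R i
hyb-≤ R E k       zero    _         = refl
hyb-≤ R E (suc k) (suc i) (s≤s i≤k) = hyb-≤ _ _ k i i≤k

hyb-next : ∀ {N} (R E : Rows N) k → hyb R E k (suc k) ≡ E k
hyb-next R E zero    = refl
hyb-next R E (suc k) = hyb-next (λ i → R (suc i)) (λ i → E (suc i)) k

hyb-other : ∀ {N} (R E : Rows N) k i → i ≢ suc k → hyb R E (suc k) i ≡ hyb R E k i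
hyb-other R E k       zero          _  = refl
hyb-other R E zero    (suc zero)    ne = ⊥-elim (ne refl)
hyb-other R E zero    (suc (suc i)) _  = refl
hyb-other R E (suc k) (suc i)       ne = hyb-other _ _ k i (λ e → ne (cong suc e))

-- Row `k + 1` is `R k` plus twice `E k`, and `R k` stands directly above it, so only the second
-- summand survives. The replacements run from the bottom up, each giving a factor 2.
D-differences : ∀ N (R E : Rows (suc N)) → (∀ i j → R (suc i) j ≡ R i j + + 2 * E i j) →
  ∀ k → k ≤ N → D (suc N) (hyb R E k) ≡ + (2 ^ k) * D (suc N) (hyb R E 0)
D-differences N R E step zero    _   = sym (ℤₚ.*-identityˡ _)
D-differences N R E step (suc k) k<N = begin
  D (suc N) (hyb R E (suc k))
    ≡⟨ D-linear (suc N) (suc k) (s≤s k<N) _ A (hyb R E k) (+ 2)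
         (λ i ne j → cong (λ r → r j) (trans (hyb-other R E k i ne) (sym (upd-other _ (suc k) (R k) i ne))))
         (λ i ne j → cong (λ r → r j) (hyb-other R E k i ne))
         (λ j → trans (cong (λ r → r j) (hyb-≤ R E (suc k) (suc k) ℕₚ.≤-refl)) (trans (step k j)
           (cong₂ (λ r s → r j + + 2 * s j) (sym (upd-same (hyb R E k) (suc k) (R k))) (sym (hyb-next R E k))))) ⟩
  D (suc N) A + + 2 * D (suc N) (hyb R E k)
    ≡⟨ cong₂ (λ x y → x + + 2 * y) (D-adjacent (suc N) k (s≤s k<N) A λ j → cong (λ r → r j) A-rows)
         (D-differences N R E step k (ℕₚ.≤-trans (ℕₚ.n≤1+n k) k<N)) ⟩
  + 0 + + 2 * (+ (2 ^ k) * D (suc N) (hyb R E 0))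
    ≡⟨ lemma (+ (2 ^ k)) _ ⟩
  + 2 * + (2 ^ k) * D (suc N) (hyb R E 0)
    ≡⟨ cong (_* D (suc N) (hyb R E 0)) (sym (ℤₚ.pos-* 2 (2 ^ k))) ⟩
  + (2 ^ suc k) * D (suc N) (hyb R E 0) ∎
  where
  open ≡-Reasoning
  A : Rows (suc N)
  A = upd (hyb R E k) (suc k) (R k)
  A-rows : A k ≡ A (suc k)
  A-rows = trans (upd-other _ (suc k) (R k) k (ℕₚ.<⇒≢ (ℕₚ.n<1+n k)))
    (trans (hyb-≤ R E k k ℕₚ.≤-refl) (sym (upd-same (hyb R E k) (suc k) (R k))))
  lemma : ∀ x y → + 0 + + 2 * (x * y) ≡ + 2 * x * y
  lemma = solve-∀

-- The tail comes first so that the sum has the shape `X j + c * Y j` of `D-upd-linear`.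
comb : ∀ {N} → Rows N → ℕ → Poly → Fin N → ℤ
comb F r []      j = + 0
comb F r (a ∷ q) j = comb F (suc r) q j + ι a * F r j

parity-comb : ∀ {N} (F : Rows N) j r (μ : ℕ → Bool) →
  (∀ i → Parity (F (i ℕ.+ r) j) (μ i)) → ∀ q → Parity (comb F r q j) (L μ q)
parity-comb F j r μ par []      = + 0 , refl
parity-comb F j r μ par (a ∷ q) = subst (λ x → Parity x (L μ (a ∷ q))) (ℤₚ.+-comm (ι a * F r j) _)
  (parity-+ (a ∧ μ 0) _ (parity-ι* a (μ 0) (par 0)) (parity-comb F j (suc r) (λ k → μ (suc k))
    (λ i → subst (λ m → Parity (F m j) (μ (suc i))) (sym (ℕₚ.+-suc i r)) (par (suc i))) q))

D-upd-repeat : ∀ N (F : Rows N) r m → suc (m ℕ.+ r) < N → D N (upd F (suc (m ℕ.+ r)) (F r)) ≡ + 0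
D-upd-repeat N F r m lt = D-alternating N r m lt (upd F l (F r)) λ j → cong (λ f → f j)
  (trans (upd-other F l (F r) r (ℕₚ.<⇒≢ (s≤s (ℕₚ.m≤n+m r m)))) (sym (upd-same F l (F r))))
  where
  l = suc (m ℕ.+ r)

-- The leading coefficient 1 falls on row `l` itself; every other term repeats a row above it and
-- contributes 0.
D-upd-comb : ∀ N (F : Rows N) l → l < N → ∀ {m q} → Monic m q → ∀ r → m ℕ.+ r ≡ l →
  D N (upd F l (comb F r q)) ≡ D N F
D-upd-comb N F l l<N one r refl = begin
  D N (upd F r (λ j → + 0 + + 1 * F r j))
    ≡⟨ D-linear N r l<N _ (upd F r (F r)) F (+ 0)
         (λ i ne j → cong (λ f → f j) (trans (upd-other F r _ i ne) (sym (upd-other F r (F r) i ne))))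
         (λ i ne j → cong (λ f → f j) (upd-other F r _ i ne))
         (λ j → trans (cong (λ f → f j) (upd-same F r _))
           (trans (lemma (F r j)) (cong (λ f → f j + + 0 * F r j) (sym (upd-same F r (F r)))))) ⟩
  D N (upd F r (F r)) + + 0 * D N F
    ≡⟨ trans (cong (λ x → D N (upd F r (F r)) + x) (ℤₚ.*-zeroˡ (D N F))) (ℤₚ.+-identityʳ _) ⟩
  D N (upd F r (F r))
    ≡⟨ D-cong N (λ i _ j → cong (λ f → f j) (upd-self F r i)) ⟩
  D N F ∎
  where
  open ≡-Reasoning
  lemma : ∀ x → + 0 + + 1 * x ≡ x + + 0 * x
  lemma = solve-∀
D-upd-comb N F l l<N {suc m} {a ∷ q} (cons a mon) r refl = begin
  D N (upd F l (λ j → comb F (suc r) q j + ι a * F r j))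
    ≡⟨ D-upd-linear N l l<N F (comb F (suc r) q) (F r) (ι a) ⟩
  D N (upd F l (comb F (suc r) q)) + ι a * D N (upd F l (F r))
    ≡⟨ cong₂ (λ x y → x + ι a * y) (D-upd-comb N F l l<N mon (suc r) (ℕₚ.+-suc m r))
         (D-upd-repeat N F r m l<N) ⟩
  D N F + ι a * + 0
    ≡⟨ trans (cong (λ x → D N F + x) (ℤₚ.*-zeroʳ (ι a))) (ℤₚ.+-identityʳ _) ⟩
  D N F ∎
  where
  open ≡-Reasoning

-- The last row can be replaced by the combination of rows 1 to n + 1 given by `q`, plus a multiple
-- of row 0, and this new row is twice an integral one.
D-even : ∀ n (F : Rows (2 ℕ.+ n)) {q} → Monic n q → (b : Bool) →
  (∀ j → Parity (comb F 1 q j + ι b * F 0 j) false) → ∃ λ k → D (2 ℕ.+ n) F ≡ + 2 * k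
D-even n F {q} mon b par = D N (upd F l Y) , (begin
  D N F
    ≡⟨ sym (D-upd-comb N F l l<N mon 1 (ℕₚ.+-suc n 0)) ⟩
  D N (upd F l (comb F 1 q))
    ≡⟨ sym (trans (cong (λ x → D N (upd F l (comb F 1 q)) + ι b * x) (D-upd-repeat N F 0 n l<N))
         (trans (cong (λ x → D N (upd F l (comb F 1 q)) + x) (ℤₚ.*-zeroʳ (ι b))) (ℤₚ.+-identityʳ _))) ⟩
  D N (upd F l (comb F 1 q)) + ι b * D N (upd F l (F 0))
    ≡⟨ sym (D-upd-linear N l l<N F (comb F 1 q) (F 0) (ι b)) ⟩
  D N (upd F l (λ j → comb F 1 q j + ι b * F 0 j))
    ≡⟨ D-linear N l l<N _ (upd F l Y) (upd F l Y) (+ 1) off off (λ j →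
         trans (cong (λ f → f j) (upd-same F l _)) (trans (proj₂ (par j)) (trans (double (Y j))
           (cong (λ f → f j + + 1 * f j) (sym (upd-same F l Y)))))) ⟩
  D N (upd F l Y) + + 1 * D N (upd F l Y)
    ≡⟨ double′ _ ⟩
  + 2 * D N (upd F l Y) ∎)
  where
  open ≡-Reasoning
  N = 2 ℕ.+ n
  l = suc (n ℕ.+ 0)
  l<N : l < N
  l<N = s≤s (s≤s (ℕₚ.≤-reflexive (ℕₚ.+-identityʳ n)))
  Y : Fin N → ℤ
  Y j = proj₁ (par j)
  off : ∀ i → i ≢ l → ∀ j → upd F l (λ j → comb F 1 q j + ι b * F 0 j) i j ≡ upd F l Y i j
  off i ne j = cong (λ f → f j) (trans (upd-other F l _ i ne) (sym (upd-other F l Y i ne)))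
  double : ∀ y → + 0 + + 2 * y ≡ y + + 1 * y
  double = solve-∀
  double′ : ∀ y → y + + 1 * y ≡ + 2 * y
  double′ = solve-∀

sign : Bool → ℤ
sign b = + 1 - + 2 * ι b

parity-sign : ∀ b → Parity (sign b) true
parity-sign b = - ι b , lemma (ι b)
  where
  lemma : ∀ x → + 1 - + 2 * x ≡ + 1 + + 2 * - x
  lemma = solve-∀

-- If zᵏ ↦ c k + c (k + 2) annihilates q, zq, …, zⁿq for q monic of degree n, then
-- the corresponding combination of the consecutive differences of the rows of the
-- Hankel matrix of size n + 2 is twice an integral vector, up to a multiple of row 0.
hankel-nondegenerate : (c : ℕ → Bool) (d : ℕ → ℤ) → (∀ n → d n ≡ sign (c n)) → Apwenian d →
  ∀ n q → Monic n q → ¬ (∀ i → i ≤ n → L (λ k → c (i ℕ.+ k) xor c (2 ℕ.+ (i ℕ.+ k))) q ≡ false)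
hankel-nondegenerate c d d≡ apw n q mon ann = contra (apw N (s≤s z≤n)) (D-even n (hyb R E 0) mon b even)
  where
  N = 2 ℕ.+ n
  R E : Rows N
  R i j = d (i ℕ.+ toℕ j)
  E i j = ι (c (i ℕ.+ toℕ j)) - ι (c (suc (i ℕ.+ toℕ j)))
  step : ∀ i j → R (suc i) j ≡ R i j + + 2 * E i j
  step i j rewrite d≡ (suc (i ℕ.+ toℕ j)) | d≡ (i ℕ.+ toℕ j) = lemma (ι (c (i ℕ.+ toℕ j))) _
    where
    lemma : ∀ x y → + 1 - + 2 * y ≡ + 1 - + 2 * x + + 2 * (x - y)
    lemma = solve-∀
  e : ℕ → Bool
  e k = c k xor c (suc k)
  s : ℕ → Bool
  s j = L (λ i → e (i ℕ.+ j)) q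
  b = s 0
  -- This stands in for the column differences: by `ann` neighbouring entries of the combined row
  -- agree modulo 2, so the row is constantly `b`, like `b` times the odd row 0.
  s-const : ∀ j → j ≤ suc n → s j ≡ b
  s-const zero    _         = refl
  s-const (suc j) (s≤s j≤n) = trans (xor-false (s j) (s (suc j))
      (trans (sym (L-xor (λ i → e (i ℕ.+ j)) (λ i → e (i ℕ.+ suc j)) q)) (trans (L-cong pt q) (ann j j≤n))))
      (s-const j (ℕₚ.m≤n⇒m≤1+n j≤n))
    where
    xor-false : ∀ x y → x xor y ≡ false → y ≡ x
    xor-false false y     eq = eq
    xor-false true  true  eq = refl
    pt : ∀ i → e (i ℕ.+ j) xor e (i ℕ.+ suc j) ≡ c (j ℕ.+ i) xor c (2 ℕ.+ (j ℕ.+ i))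
    pt i rewrite ℕₚ.+-suc i j | ℕₚ.+-comm i j =
      solve₂ 3 (λ x y z → (x :+ y) :+ (y :+ z) := x :+ z) refl (c (j ℕ.+ i)) (c (suc (j ℕ.+ i))) _
  parE : ∀ i j → Parity (E i j) (e (i ℕ.+ toℕ j))
  parE i j = parity-+ x y (parity-ι x) (parity-neg y (parity-ι y))
    where
    x = c (i ℕ.+ toℕ j)
    y = c (suc (i ℕ.+ toℕ j))
  even : ∀ j → Parity (comb (hyb R E 0) 1 q j + ι b * d (toℕ j)) false
  even j = subst (Parity _) (cancel (s-const (toℕ j) (ℕₚ.≤-pred (Finₚ.toℕ<n j))))
    (parity-+ (s (toℕ j)) (b ∧ true)
      (parity-comb (hyb R E 0) j 1 _ (λ i → subst (λ m → Parity (hyb R E 0 m j) (e (i ℕ.+ toℕ j)))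
        (sym (ℕₚ.+-comm i 1)) (parE i j)) q)
      (parity-ι* b true (subst (λ x → Parity x true) (sym (d≡ (toℕ j))) (parity-sign (c (toℕ j))))))
    where
    cancel : ∀ {x y} → x ≡ y → x xor (y ∧ true) ≡ false
    cancel {false} refl = refl
    cancel {true}  refl = refl
  hankel≡ : Hankel N d ≡ + (2 ^ suc n) * D N (hyb R E 0)
  hankel≡ = trans (D-cong N {R} {hyb R E (suc n)}
      (λ i i<N j → cong (λ r → r j) (sym (hyb-≤ R E (suc n) i (ℕₚ.≤-pred i<N)))))
    (D-differences (suc n) R E step (suc n) ℕₚ.≤-refl)
  contra : (∃ λ k → Hankel N d ≡ + (2 ^ suc n) * (+ 1 + + 2 * k)) →
    (∃ λ k → D N (hyb R E 0) ≡ + 2 * k) → ⊥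
  contra (k , odd) (l , ev) = odd≢even k l (trans (ℤₚ.*-cancelˡ-≡ (+ (2 ^ suc n)) _ _
    {{ℕₚ.m^n≢0 2 (suc n)}} (trans (sym odd) hankel≡)) ev)

-- Orthogonal polynomials over 𝔽₂

infixl 6 _⊕_

_⊕_ : Poly → Poly → Poly
[]      ⊕ q       = q
(a ∷ p) ⊕ []      = a ∷ p
(a ∷ p) ⊕ (b ∷ q) = (a xor b) ∷ (p ⊕ q)

_⊙_ : Bool → Poly → Poly
false ⊙ q = []
true  ⊙ q = q

L-⊕ : ∀ μ p q → L μ (p ⊕ q) ≡ L μ p xor L μ q
L-⊕ μ []      q       = refl
L-⊕ μ (a ∷ p) []      = solve₂ 1 (λ x → x := x :+ con false) refl (L μ (a ∷ p))
L-⊕ μ (a ∷ p) (b ∷ q) rewrite L-⊕ (λ k → μ (suc k)) p q =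
  solve₂ 5 (λ a b m s t → (a :+ b) :* m :+ (s :+ t) := (a :* m :+ s) :+ (b :* m :+ t)) refl a b (μ 0) _ _

L-⊙ : ∀ μ b q → L μ (b ⊙ q) ≡ b ∧ L μ q
L-⊙ μ false q = refl
L-⊙ μ true  q = refl

⊙-length : ∀ b q → length (b ⊙ q) ≤ length q
⊙-length false q = z≤n
⊙-length true  q = ℕₚ.≤-refl

Monic-⊕ : ∀ {n p} q → Monic n p → length q ≤ n → Monic n (p ⊕ q)
Monic-⊕ []      one          _         = one
Monic-⊕ []      (cons a mon) _         = cons a mon
Monic-⊕ (b ∷ q) (cons a mon) (s≤s len) = cons (a xor b) (Monic-⊕ q mon len)

Monic-length : ∀ {n p} → Monic n p → length p ≡ suc n
Monic-length one          = refl
Monic-length (cons a mon) = cong suc (Monic-length mon)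

L-short : ∀ n μ q → length q ≤ n → (∀ i → i < n → μ i ≡ false) → L μ q ≡ false
L-short n       μ []      _         _    = refl
L-short (suc n) μ (a ∷ q) (s≤s len) vanish
  rewrite vanish 0 (s≤s z≤n) | L-short n (λ k → μ (suc k)) q len (λ i i<n → vanish (suc i) (s≤s i<n)) =
    solve₂ 1 (λ a → a :* con false :+ con false := con false) refl a

L-monic : ∀ {n p} μ → Monic n p → (∀ i → i < n → μ i ≡ false) → L μ p ≡ μ n
L-monic μ one          _ = solve₂ 1 (λ x → x :+ con false := x) refl (μ 0)
L-monic {suc n} μ (cons a mon) vanish
  rewrite vanish 0 (s≤s z≤n) | L-monic (λ k → μ (suc k)) mon (λ i i<n → vanish (suc i) (s≤s i<n)) =
    solve₂ 2 (λ a x → a :* con false :+ x := x) refl a (μ (suc n))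

-- Monic polynomials of all degrees form a triangular basis: once the lower moments vanish, only the
-- leading term contributes.
monic-basis : ∀ (μ : ℕ → Bool) → (∀ n → ∃ λ q → ∃ λ (_ : Monic n q) → L μ q ≡ false) →
  ∀ n → μ n ≡ false
monic-basis μ basis n = below (suc n) n (ℕₚ.n<1+n n)
  where
  below : ∀ n i → i < n → μ i ≡ false
  below (suc n) i (s≤s i≤n) with ℕₚ.m≤n⇒m<n∨m≡n i≤n
  ... | inj₁ i<n  = below n i i<n
  ... | inj₂ refl with basis i
  ...   | q , mon , eq = trans (sym (L-monic μ mon (below i))) eq

-- The bilinear form of a functional

-- mom g q i is the value at zⁱ q of the functional zᵏ ↦ g k; hence B g p q is its value at p q.
mom : (ℕ → Bool) → Poly → ℕ → Bool
mom g q i = L (λ k → g (i ℕ.+ k)) q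

B : (ℕ → Bool) → Poly → Poly → Bool
B g p q = L (mom g q) p

shift : (ℕ → Bool) → ℕ → Bool
shift g k = g (suc k)

mom-cons : ∀ g b q i → mom g (b ∷ q) i ≡ (b ∧ g i) xor mom (shift g) q i
mom-cons g b q i = cong₂ (λ x y → (b ∧ g x) xor y) (ℕₚ.+-identityʳ i)
  (L-cong (λ k → cong g (ℕₚ.+-suc i k)) q)

L-scale : ∀ a μ q → L (λ k → a ∧ μ k) q ≡ a ∧ L μ q
L-scale a μ []      = solve₂ 1 (λ a → con false := a :* con false) refl a
L-scale a μ (b ∷ q) rewrite L-scale a (λ k → μ (suc k)) q =
  solve₂ 4 (λ a b m t → b :* (a :* m) :+ a :* t := a :* (b :* m :+ t)) refl a b (μ 0) _

B-consʳ : ∀ g b p q → B g p (b ∷ q) ≡ (b ∧ L g p) xor B (shift g) p q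
B-consʳ g b p q = trans (L-cong (mom-cons g b q) p)
  (trans (L-xor (λ k → b ∧ g k) (mom (shift g) q) p) (cong (_xor B (shift g) p q) (L-scale b g p)))

B-nilʳ : ∀ g p → B g p [] ≡ false
B-nilʳ g []      = refl
B-nilʳ g (a ∷ p) rewrite B-nilʳ (shift g) p = solve₂ 1 (λ a → a :* con false :+ con false := con false) refl a

B-sym : ∀ g p q → B g p q ≡ B g q p
B-sym g []      q = sym (B-nilʳ g q)
B-sym g (a ∷ p) q = trans (cong ((a ∧ L g q) xor_) (B-sym (shift g) p q)) (sym (B-consʳ g a q p))

-- Over 𝔽₂ the diagonal of the form is additive: (Σ aⱼ zʲ)² = Σ aⱼ z²ʲ.
B-square : ∀ g q → B g q q ≡ L (λ k → g (k ℕ.+ k)) q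
B-square g []      = refl
B-square g (a ∷ q) = begin
  (a ∧ ((a ∧ g 0) xor L (shift g) q)) xor B (shift g) q (a ∷ q)
    ≡⟨ cong ((a ∧ ((a ∧ g 0) xor L (shift g) q)) xor_) (B-consʳ (shift g) a q q) ⟩
  (a ∧ ((a ∧ g 0) xor L (shift g) q)) xor ((a ∧ L (shift g) q) xor B (shift (shift g)) q q)
    ≡⟨ lemma a (g 0) (L (shift g) q) _ ⟩
  (a ∧ g 0) xor B (shift (shift g)) q q
    ≡⟨ cong ((a ∧ g 0) xor_) (trans (B-square (shift (shift g)) q)
         (L-cong (λ k → cong (λ m → g (suc m)) (sym (ℕₚ.+-suc k k))) q)) ⟩
  (a ∧ g 0) xor L (λ k → g (suc k ℕ.+ suc k)) q ∎
  where
  open ≡-Reasoning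
  lemma : ∀ a x l s → (a ∧ ((a ∧ x) xor l)) xor ((a ∧ l) xor s) ≡ (a ∧ x) xor s
  lemma false x     l     s = refl
  lemma true  x     false s = solve₂ 2 (λ x s → (x :+ con false) :+ (con false :+ s) := x :+ s) refl x s
  lemma true  x     true  s = solve₂ 2 (λ x s → (x :+ con true) :+ (con true :+ s) := x :+ s) refl x s

module Orthogonal (g : ℕ → Bool)
  (nondegenerate : ∀ n q → Monic n q → ¬ (∀ i → i ≤ n → mom g q i ≡ false)) where

  -- q is the n-th orthogonal polynomial, r the one before it (r = 0 for n = 0).
  record Stage (n : ℕ) : Set where
    field
      q r     : Poly
      monic   : Monic n q
      short   : length r ≤ n
      orth    : ∀ i → i < n → mom g q i ≡ false
      norm    : mom g q n ≡ true
      -- Both sides are 0 for i + 1 < n and 1 for i + 1 = n; this is why `r` gets coefficient 1 in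
      -- the recurrence.
      prev    : ∀ i → i < n → mom g q (suc i) ≡ mom g r i
      -- A uniform form of L(r²) + L(q) = 1: the summands are 0 and 1 in degree 0, and 1 and 0 in
      -- every later degree.
      squares : B g r r xor mom g q 0 ≡ true

  norm-true : ∀ n q → Monic n q → (∀ i → i < n → mom g q i ≡ false) → mom g q n ≡ true
  norm-true n q mon orth with mom g q n in eq
  ... | true  = refl
  ... | false = ⊥-elim (nondegenerate n q mon λ i i≤n → vanish i (ℕₚ.m≤n⇒m<n∨m≡n i≤n))
    where
    vanish : ∀ i → i < n ⊎ i ≡ n → mom g q i ≡ false
    vanish i (inj₁ i<n)  = orth i i<n
    vanish i (inj₂ refl) = eq

  module Step {n} (S : Stage n) where
    open Stage S

    -- Chosen to make `q⁺` orthogonal to zⁿ, where `norm` gives `b` the factor 1.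
    b : Bool
    b = mom g q (suc n) xor mom g r n

    q⁺ : Poly
    q⁺ = (false ∷ q) ⊕ (b ⊙ q) ⊕ r

    L-q⁺ : ∀ μ → L μ q⁺ ≡ (L (λ k → μ (suc k)) q xor (b ∧ L μ q)) xor L μ r
    L-q⁺ μ = trans (L-⊕ μ ((false ∷ q) ⊕ (b ⊙ q)) r) (cong (_xor L μ r)
      (trans (L-⊕ μ (false ∷ q) (b ⊙ q)) (cong (L (λ k → μ (suc k)) q xor_) (L-⊙ μ b q))))

    mom-q⁺ : ∀ i → mom g q⁺ i ≡ (mom g q (suc i) xor (b ∧ mom g q i)) xor mom g r i
    mom-q⁺ i = trans (L-q⁺ (λ k → g (i ℕ.+ k)))
      (cong (λ x → (x xor (b ∧ mom g q i)) xor mom g r i) (L-cong (λ k → cong g (ℕₚ.+-suc i k)) q))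

    monic⁺ : Monic (suc n) q⁺
    monic⁺ = Monic-⊕ r (Monic-⊕ (b ⊙ q) (cons false monic)
      (ℕₚ.≤-trans (⊙-length b q) (ℕₚ.≤-reflexive (Monic-length monic)))) (ℕₚ.m≤n⇒m≤1+n short)

    orth⁺ : ∀ i → i < suc n → mom g q⁺ i ≡ false
    orth⁺ i (s≤s i≤n) with ℕₚ.m≤n⇒m<n∨m≡n i≤n
    ... | inj₁ i<n rewrite mom-q⁺ i | orth i i<n | prev i i<n =
          solve₂ 2 (λ b x → (x :+ b :* con false) :+ x := con false) refl b (mom g r i)
    ... | inj₂ refl rewrite mom-q⁺ n | norm =
          solve₂ 2 (λ x y → (x :+ (x :+ y) :* con true) :+ y := con false) refl (mom g q (suc n)) (mom g r n)

    norm⁺ : mom g q⁺ (suc n) ≡ true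
    norm⁺ = norm-true (suc n) q⁺ monic⁺ orth⁺

    B-qq : B g q q ≡ true
    B-qq = trans (L-monic (mom g q) monic orth) norm

    next : Stage (suc n)
    next = record
      { q = q⁺ ; r = q ; monic = monic⁺ ; short = ℕₚ.≤-reflexive (Monic-length monic)
      ; orth = orth⁺ ; norm = norm⁺ ; prev = prev⁺
      ; squares = cong₂ _xor_ B-qq (orth⁺ 0 (s≤s z≤n)) }
      where
      prev⁺ : ∀ i → i < suc n → mom g q⁺ (suc i) ≡ mom g q i
      prev⁺ i (s≤s i≤n) with ℕₚ.m≤n⇒m<n∨m≡n i≤n
      ... | inj₁ i<n  = trans (orth⁺ (suc i) (s≤s i<n)) (sym (orth i i<n))
      ... | inj₂ refl = trans norm⁺ (sym norm)

    -- The recurrence is substituted in one factor of z q · q; `q⁺` is orthogonal to `q`, `q` to the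
    -- shorter `r`, and L(q²) = 1.
    B-z : B (shift g) q q ≡ b
    B-z = begin
      B (shift g) q q
        ≡⟨ lemma (B (shift g) q q) b ⟩
      ((B (shift g) q q xor (b ∧ true)) xor false) xor b
        ≡⟨ cong (_xor b) (cong₂ (λ x y → (B (shift g) q q xor (b ∧ x)) xor y)
             (sym B-qq) (sym (L-short n (mom g q) r short orth))) ⟩
      ((B (shift g) q q xor (b ∧ B g q q)) xor B g r q) xor b
        ≡⟨ cong (_xor b) (sym (L-q⁺ (mom g q))) ⟩
      B g q⁺ q xor b
        ≡⟨ cong (_xor b) (trans (B-sym g q⁺ q)
             (L-short (suc n) (mom g q⁺) q (ℕₚ.≤-reflexive (Monic-length monic)) orth⁺)) ⟩
      b ∎
      where
      open ≡-Reasoning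
      lemma : ∀ x b → x ≡ ((x xor (b ∧ true)) xor false) xor b
      lemma = solve₂ 2 (λ x b → x := ((x :+ b :* con true) :+ con false) :+ b) refl

    -- By `B-square` the diagonal is additive, so squaring the recurrence produces no cross terms;
    -- moreover L(q⁺²) = L(q²) = 1.
    B-zz : B (shift (shift g)) q q ≡ (true xor b) xor B g r r
    B-zz = begin
      B (shift (shift g)) q q
        ≡⟨ trans (B-square (shift (shift g)) q) (L-cong (λ k → cong (λ m → g (suc m)) (sym (ℕₚ.+-suc k k))) q) ⟩
      L (λ k → sq (suc k)) q
        ≡⟨ lemma (L (λ k → sq (suc k)) q) (L sq q) b (L sq r) ⟩
      (((L (λ k → sq (suc k)) q xor (b ∧ L sq q)) xor L sq r) xor (b ∧ L sq q)) xor L sq r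
        ≡⟨ cong₂ (λ x y → (x xor (b ∧ y)) xor L sq r) (sym (L-q⁺ sq)) (trans (sym (B-square g q)) B-qq) ⟩
      (L sq q⁺ xor (b ∧ true)) xor L sq r
        ≡⟨ cong₂ (λ x y → (x xor (b ∧ true)) xor y)
             (trans (sym (B-square g q⁺)) (trans (L-monic (mom g q⁺) monic⁺ orth⁺) norm⁺))
             (sym (B-square g r)) ⟩
      (true xor (b ∧ true)) xor B g r r
        ≡⟨ solve₂ 2 (λ b x → (con true :+ b :* con true) :+ x := (con true :+ b) :+ x) refl b (B g r r) ⟩
      (true xor b) xor B g r r ∎
      where
      open ≡-Reasoning
      sq : ℕ → Bool
      sq k = g (k ℕ.+ k)
      lemma : ∀ x y b r → x ≡ (((x xor (b ∧ y)) xor r) xor (b ∧ y)) xor r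
      lemma = solve₂ 4 (λ x y b r → x := (((x :+ b :* y) :+ r) :+ b :* y) :+ r) refl

    -- zq = q⁺ + bq + r gives L(z q²) = b and L(z² q²) = L(q⁺²) + b + L(r²).
    vanish : L (λ k → (g (2 ℕ.+ (k ℕ.+ k)) xor g (1 ℕ.+ (k ℕ.+ k))) xor g k) q ≡ false
    vanish = begin
      L (λ k → (g (2 ℕ.+ (k ℕ.+ k)) xor g (1 ℕ.+ (k ℕ.+ k))) xor g k) q
        ≡⟨ trans (L-xor _ g q) (cong (_xor L g q) (L-xor (λ k → g (2 ℕ.+ (k ℕ.+ k))) _ q)) ⟩
      (L (λ k → g (2 ℕ.+ (k ℕ.+ k))) q xor L (λ k → g (1 ℕ.+ (k ℕ.+ k))) q) xor mom g q 0
        ≡⟨ cong₂ (λ x y → (x xor y) xor mom g q 0)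
             (trans (sym (B-square (shift (shift g)) q)) B-zz)
             (trans (sym (B-square (shift g) q)) B-z) ⟩
      (((true xor b) xor B g r r) xor b) xor mom g q 0
        ≡⟨ solve₂ 3 (λ b x y → (((con true :+ b) :+ x) :+ b) :+ y := con true :+ (x :+ y)) refl
             b (B g r r) (mom g q 0) ⟩
      true xor (B g r r xor mom g q 0)
        ≡⟨ cong (true xor_) squares ⟩
      false ∎
      where open ≡-Reasoning

  stage : ∀ n → Stage n
  stage zero = record
    { q = true ∷ [] ; r = [] ; monic = one ; short = z≤n ; orth = λ _ () ; norm = norm₀
    ; prev = λ _ () ; squares = norm₀ }
    where
    norm₀ : mom g (true ∷ []) 0 ≡ true
    norm₀ = norm-true 0 (true ∷ []) one (λ _ ())
  stage (suc n) = Step.next (stage n)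

  recurrence : ∀ n → (g (2 ℕ.+ (n ℕ.+ n)) xor g (1 ℕ.+ (n ℕ.+ n))) xor g n ≡ false
  recurrence = monic-basis _ λ n → Stage.q (stage n) , Stage.monic (stage n) , Step.vanish (stage n)

  g₀ : g 0 ≡ true
  g₀ = trans (solve₂ 1 (λ x → x := x :+ con false) refl (g 0)) (Stage.norm (stage 0))

-- The recurrence for g at `n` is the sum of the relations at `n` and `n + 1`, so the relation
-- propagates from 0, where it reads g 0 = 1.
apwenian-relation : (c : ℕ → Bool) (d : ℕ → ℤ) → (∀ n → d n ≡ sign (c n)) → Apwenian d →
  ∀ n → (c n xor c (suc n)) xor (c (1 ℕ.+ (n ℕ.+ n)) xor c (2 ℕ.+ (n ℕ.+ n))) ≡ true
apwenian-relation c d d≡ apw = relation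
  where
  open Orthogonal (λ k → c k xor c (2 ℕ.+ k)) (hankel-nondegenerate c d d≡ apw)
  step : ∀ x y z x₁ x₂ x₃ x₄ → ((x₂ xor x₄) xor (x₁ xor x₃)) xor (x xor z) ≡ false →
    (x xor y) xor (x₁ xor x₂) ≡ true → (y xor z) xor (x₃ xor x₄) ≡ true
  step x y z x₁ x₂ x₃ x₄ e e′ = begin
    (y xor z) xor (x₃ xor x₄)
      ≡⟨ solve₂ 7 (λ x y z x₁ x₂ x₃ x₄ → (y :+ z) :+ (x₃ :+ x₄) :=
           (((x₂ :+ x₄) :+ (x₁ :+ x₃)) :+ (x :+ z)) :+ ((x :+ y) :+ (x₁ :+ x₂))) refl x y z x₁ x₂ x₃ x₄ ⟩
    (((x₂ xor x₄) xor (x₁ xor x₃)) xor (x xor z)) xor ((x xor y) xor (x₁ xor x₂))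
      ≡⟨ cong₂ _xor_ e e′ ⟩
    true ∎
    where open ≡-Reasoning
  relation : ∀ n → (c n xor c (suc n)) xor (c (1 ℕ.+ (n ℕ.+ n)) xor c (2 ℕ.+ (n ℕ.+ n))) ≡ true
  relation zero    = trans (solve₂ 3 (λ x y z → (x :+ y) :+ (y :+ z) := x :+ z) refl (c 0) (c 1) (c 2)) g₀
  relation (suc n) rewrite ℕₚ.+-suc n n =
    step (c n) (c (suc n)) _ (c (1 ℕ.+ (n ℕ.+ n))) _ _ _ (recurrence n) (relation n)

-- The substitution and the relation c n + c (n + 1) + c (2n + 1) + c (2n + 2) = 1

half : ∀ i → ∃ λ j → i ≡ j ℕ.+ j ⊎ i ≡ suc (j ℕ.+ j)
half zero    = 0 , inj₁ refl
half (suc i) with half i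
... | j , inj₁ refl = j , inj₂ refl
... | j , inj₂ refl = suc j , inj₁ (cong suc (sym (ℕₚ.+-suc j j)))

-- Deleting the binary digits of `i` from the right leads down to 0 without leaving the range below
-- `p`.
halving-invariant : (δ : ℕ → Bool) (p : ℕ) →
  (∀ j → j ℕ.+ j < p → δ (j ℕ.+ j) ≡ δ j) → (∀ j → suc (j ℕ.+ j) < p → δ (suc (j ℕ.+ j)) ≡ δ j) →
  ∀ i → i < p → δ i ≡ δ 0
halving-invariant δ p even odd i = go i i ℕₚ.≤-refl
  where
  go : ∀ f i → i ≤ f → i < p → δ i ≡ δ 0
  go zero    zero    _   _   = refl
  go (suc f) i       i≤f i<p with half i
  ... | zero  , inj₁ refl = refl
  ... | suc j , inj₁ refl = trans (even (suc j) i<p) (go f (suc j)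
          (ℕₚ.≤-trans (ℕₚ.m≤n+m (suc j) j) (ℕₚ.≤-pred i≤f)) (ℕₚ.≤-<-trans (ℕₚ.m≤m+n (suc j) (suc j)) i<p))
  ... | j     , inj₂ refl = trans (odd j i<p) (go f j
          (ℕₚ.≤-trans (ℕₚ.m≤m+n j j) (ℕₚ.≤-pred i≤f)) (ℕₚ.≤-<-trans (ℕₚ.m≤n⇒m≤1+n (ℕₚ.m≤m+n j j)) i<p))

xor-≡ : ∀ x y → x xor y ≡ false → x ≡ y
xor-≡ false y    eq = sym eq
xor-≡ true  true eq = refl

module Automatic (l : ℕ) (c v δ : ℕ → Bool)
  (c₀ : c 0 ≡ false)
  (automatic : ∀ n i → i < suc l → c (i ℕ.+ n ℕ.* suc l) ≡ v i xor (δ i ∧ c n))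
  (relation : ∀ n → (c n xor c (suc n)) xor (c (1 ℕ.+ (n ℕ.+ n)) xor c (2 ℕ.+ (n ℕ.+ n))) ≡ true) where

  private
    p = suc l

  c₂ : c 2 ≡ true
  c₂ = trans (lemma (c 1) (c 2)) (trans (cong (λ x → (x xor c 1) xor (c 1 xor c 2)) (sym c₀)) (relation 0))
    where
    lemma : ∀ x y → y ≡ (false xor x) xor (x xor y)
    lemma = solve₂ 2 (λ x y → y := (con false :+ x) :+ (x :+ y)) refl

  -- The argument starts at 1: at 0 the formula would force κ = 1.
  even-from-odd : ∀ κ → (∀ n → c (1 ℕ.+ (n ℕ.+ n)) ≡ c n xor κ) →
    ∀ n → c (suc n ℕ.+ suc n) ≡ c (suc n) xor (true xor κ)
  even-from-odd κ odd n rewrite ℕₚ.+-suc n n = begin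
    c (2 ℕ.+ (n ℕ.+ n))
      ≡⟨ solve₂ 4 (λ a b x κ → x := ((a :+ b) :+ ((a :+ κ) :+ x)) :+ (b :+ κ)) refl (c n) (c (suc n)) _ κ ⟩
    ((c n xor c (suc n)) xor ((c n xor κ) xor c (2 ℕ.+ (n ℕ.+ n)))) xor (c (suc n) xor κ)
      ≡⟨ cong (λ x → ((c n xor c (suc n)) xor (x xor c (2 ℕ.+ (n ℕ.+ n)))) xor (c (suc n) xor κ)) (sym (odd n)) ⟩
    ((c n xor c (suc n)) xor (c (1 ℕ.+ (n ℕ.+ n)) xor c (2 ℕ.+ (n ℕ.+ n)))) xor (c (suc n) xor κ)
      ≡⟨ cong (_xor (c (suc n) xor κ)) (relation n) ⟩
    true xor (c (suc n) xor κ)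
      ≡⟨ solve₂ 2 (λ b κ → con true :+ (b :+ κ) := b :+ (con true :+ κ)) refl (c (suc n)) κ ⟩
    c (suc n) xor (true xor κ) ∎
    where open ≡-Reasoning

  -- Such a c is determined, up to κ, by the binary digits of its argument (κ = 1 is the
  -- Thue–Morse sequence), and then so is the dependence of c (i + n p) on c n.
  δ-constant : ∀ κ → (∀ n → c (1 ℕ.+ (n ℕ.+ n)) ≡ c n xor κ) → ∀ i → i < p → δ i ≡ δ 0
  δ-constant κ odd = halving-invariant δ p
    (λ j 2j<p → compare (v (j ℕ.+ j)) (δ (j ℕ.+ j)) (v j) (δ j) (true xor κ)
      (double j 2j<p 1 c₂) (double j 2j<p 2 c₃))
    (λ j 2j<p → compare (v (suc (j ℕ.+ j))) (δ (suc (j ℕ.+ j))) (v j) (δ j) κ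
      (double+1 j 2j<p 1 c₂) (double+1 j 2j<p 2 c₃))
    where
    κ′ = true xor κ
    -- `even` covers positive arguments only, so `c 3` and not `c 0` supplies the value 0 to set
    -- against `c 2`.
    c₃ : c 3 ≡ false
    c₃ = trans (odd 1) (trans (cong (_xor κ) (trans (odd 0) (cong (_xor κ) c₀)))
      (solve₂ 1 (λ κ → (con false :+ κ) :+ κ := con false) refl κ))
    even = even-from-odd κ odd
    low : ∀ {j} → j ℕ.+ j < p → j < p
    low {j} = ℕₚ.≤-<-trans (ℕₚ.m≤m+n j j)
    lowˢ : ∀ {j} → suc (j ℕ.+ j) < p → j < p
    lowˢ {j} 2j<p = low (ℕₚ.<-trans (ℕₚ.n<1+n (j ℕ.+ j)) 2j<p)
    index : ∀ j n p → (j ℕ.+ n ℕ.* p) ℕ.+ (j ℕ.+ n ℕ.* p) ≡ (j ℕ.+ j) ℕ.+ (n ℕ.+ n) ℕ.* p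
    index = ℕSolver.solve-∀
    positive : ∀ j n → ∃ λ m → suc m ≡ j ℕ.+ suc n ℕ.* p
    positive j n = j ℕ.+ (l ℕ.+ n ℕ.* p) , sym (ℕₚ.+-suc j _)
    -- The value of c at 2(j + (n + 1) p), computed by blocks and by halving.
    double : ∀ j → j ℕ.+ j < p → ∀ n {b} → c (suc n) ≡ b →
      v (j ℕ.+ j) xor (δ (j ℕ.+ j) ∧ (b xor κ′)) ≡ (v j xor (δ j ∧ b)) xor κ′
    double j 2j<p n refl with positive j n
    ... | m , m≡ = begin
      v (j ℕ.+ j) xor (δ (j ℕ.+ j) ∧ (c (suc n) xor κ′))
        ≡⟨ cong (λ x → v (j ℕ.+ j) xor (δ (j ℕ.+ j) ∧ x)) (sym (even n)) ⟩
      v (j ℕ.+ j) xor (δ (j ℕ.+ j) ∧ c (suc n ℕ.+ suc n))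
        ≡⟨ sym (automatic (suc n ℕ.+ suc n) (j ℕ.+ j) 2j<p) ⟩
      c ((j ℕ.+ j) ℕ.+ (suc n ℕ.+ suc n) ℕ.* p)
        ≡⟨ cong c (trans (sym (index j (suc n) p)) (sym (cong₂ ℕ._+_ m≡ m≡))) ⟩
      c (suc m ℕ.+ suc m)
        ≡⟨ even m ⟩
      c (suc m) xor κ′
        ≡⟨ cong (_xor κ′) (trans (cong c m≡) (automatic (suc n) j (low 2j<p))) ⟩
      (v j xor (δ j ∧ c (suc n))) xor κ′ ∎
      where open ≡-Reasoning
    double+1 : ∀ j → suc (j ℕ.+ j) < p → ∀ n {b} → c (suc n) ≡ b →
      v (suc (j ℕ.+ j)) xor (δ (suc (j ℕ.+ j)) ∧ (b xor κ′)) ≡ (v j xor (δ j ∧ b)) xor κ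
    double+1 j 2j<p n refl = begin
      v (suc (j ℕ.+ j)) xor (δ (suc (j ℕ.+ j)) ∧ (c (suc n) xor κ′))
        ≡⟨ cong (λ x → v (suc (j ℕ.+ j)) xor (δ (suc (j ℕ.+ j)) ∧ x)) (sym (even n)) ⟩
      v (suc (j ℕ.+ j)) xor (δ (suc (j ℕ.+ j)) ∧ c (suc n ℕ.+ suc n))
        ≡⟨ sym (automatic (suc n ℕ.+ suc n) (suc (j ℕ.+ j)) 2j<p) ⟩
      c (suc ((j ℕ.+ j) ℕ.+ (suc n ℕ.+ suc n) ℕ.* p))
        ≡⟨ cong (λ m → c (suc m)) (sym (index j (suc n) p)) ⟩
      c (suc ((j ℕ.+ suc n ℕ.* p) ℕ.+ (j ℕ.+ suc n ℕ.* p)))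
        ≡⟨ odd (j ℕ.+ suc n ℕ.* p) ⟩
      c (j ℕ.+ suc n ℕ.* p) xor κ
        ≡⟨ cong (_xor κ) (automatic (suc n) j (lowˢ 2j<p)) ⟩
      (v j xor (δ j ∧ c (suc n))) xor κ ∎
      where open ≡-Reasoning
    -- Adding the two equations cancels all but `δ₁` and `δ₂`.
    compare : ∀ v₁ δ₁ v₂ δ₂ k → v₁ xor (δ₁ ∧ (true xor κ′)) ≡ (v₂ xor (δ₂ ∧ true)) xor k →
      v₁ xor (δ₁ ∧ (false xor κ′)) ≡ (v₂ xor (δ₂ ∧ false)) xor k → δ₁ ≡ δ₂
    compare v₁ δ₁ v₂ δ₂ k e e′ = begin
      δ₁ ≡⟨ solve₂ 3 (λ v δ κ → δ := (v :+ δ :* (con true :+ κ)) :+ (v :+ δ :* (con false :+ κ))) refl v₁ δ₁ κ′ ⟩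
      (v₁ xor (δ₁ ∧ (true xor κ′))) xor (v₁ xor (δ₁ ∧ (false xor κ′))) ≡⟨ cong₂ _xor_ e e′ ⟩
      ((v₂ xor (δ₂ ∧ true)) xor k) xor ((v₂ xor (δ₂ ∧ false)) xor k)
        ≡⟨ solve₂ 3 (λ v δ k → ((v :+ δ :* con true) :+ k) :+ ((v :+ δ :* con false) :+ k) := δ) refl v₂ δ₂ k ⟩
      δ₂ ∎
      where open ≡-Reasoning

  -- The relation at the last position of block `n`: the next position opens block n + 1, and the
  -- doubled pair straddles blocks 2n + 1 and 2n + 2 in the same way, so the `v` terms cancel.
  boundary : ∀ n → (δ l ∧ (c n xor c (1 ℕ.+ (n ℕ.+ n)))) xor (δ 0 ∧ (c (suc n) xor c (2 ℕ.+ (n ℕ.+ n)))) ≡ true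
  boundary n = trans (lemma (v l) (δ l) (v 0) (δ 0) (c n) (c (suc n)) (c (1 ℕ.+ (n ℕ.+ n))) (c (2 ℕ.+ (n ℕ.+ n))))
    (trans (sym (cong₂ _xor_
        (cong₂ _xor_ (automatic n l l<p) (automatic (suc n) 0 (s≤s z≤n)))
        (cong₂ _xor_ (trans (cong c (index₁ l n)) (automatic (1 ℕ.+ (n ℕ.+ n)) l l<p))
                     (trans (cong c (index₂ l n)) (automatic (2 ℕ.+ (n ℕ.+ n)) 0 (s≤s z≤n))))))
      (relation (l ℕ.+ n ℕ.* p)))
    where
    l<p = ℕₚ.n<1+n l
    index₁ : ∀ l n → 1 ℕ.+ ((l ℕ.+ n ℕ.* suc l) ℕ.+ (l ℕ.+ n ℕ.* suc l)) ≡ l ℕ.+ (1 ℕ.+ (n ℕ.+ n)) ℕ.* suc l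
    index₁ = ℕSolver.solve-∀
    index₂ : ∀ l n → 2 ℕ.+ ((l ℕ.+ n ℕ.* suc l) ℕ.+ (l ℕ.+ n ℕ.* suc l)) ≡ (2 ℕ.+ (n ℕ.+ n)) ℕ.* suc l
    index₂ = ℕSolver.solve-∀
    lemma : ∀ v δ v₀ δ₀ x y z t → (δ ∧ (x xor z)) xor (δ₀ ∧ (y xor t)) ≡
      ((v xor (δ ∧ x)) xor (v₀ xor (δ₀ ∧ y))) xor ((v xor (δ ∧ z)) xor (v₀ xor (δ₀ ∧ t)))
    lemma = solve₂ 8 (λ v δ v₀ δ₀ x y z t → (δ :* (x :+ z)) :+ (δ₀ :* (y :+ t)) :=
      ((v :+ (δ :* x)) :+ (v₀ :+ (δ₀ :* y))) :+ ((v :+ (δ :* z)) :+ (v₀ :+ (δ₀ :* t)))) refl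

  xor-shuffle : ∀ x y k → x xor y ≡ k → y ≡ x xor k
  xor-shuffle x y _ refl = solve₂ 2 (λ x y → y := x :+ (x :+ y)) refl x y

  true≢false : ∀ {A : Set} {x} → x ≡ true → x ≡ false → A
  true≢false refl ()

  -- If both ends were 0, `boundary` would read 0 = 1. If exactly one is 0, it yields c (2n + 1) = c
  -- n + κ, and `δ-constant` makes the ends equal.
  δ-ends : δ 0 ≡ true × δ l ≡ true
  δ-ends = ends (δ 0) (δ l) refl refl
    where
    ends : ∀ x y → δ 0 ≡ x → δ l ≡ y → δ 0 ≡ true × δ l ≡ true
    ends true  true  e₀ eₗ = e₀ , eₗ
    ends false false e₀ eₗ = true≢false (boundary 0) (cong₂ (λ x y →
      (y ∧ (c 0 xor c 1)) xor (x ∧ (c 1 xor c 2))) e₀ eₗ)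
    ends false true  e₀ eₗ = true≢false (trans (sym (δ-constant true odd l (ℕₚ.n<1+n l))) eₗ) e₀
      where
      odd : ∀ n → c (1 ℕ.+ (n ℕ.+ n)) ≡ c n xor true
      odd n = xor-shuffle (c n) _ true (trans (solve₂ 1 (λ x → x := x :+ con false) refl _)
        (trans (sym (cong₂ (λ x y → (y ∧ (c n xor c (1 ℕ.+ (n ℕ.+ n)))) xor
          (x ∧ (c (suc n) xor c (2 ℕ.+ (n ℕ.+ n))))) e₀ eₗ)) (boundary n)))
    ends true  false e₀ eₗ = true≢false e₀ (trans (sym (δ-constant false odd l (ℕₚ.n<1+n l))) eₗ)
      where
      odd : ∀ n → c (1 ℕ.+ (n ℕ.+ n)) ≡ c n xor false
      odd n = xor-shuffle (c n) _ false (trans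
        (solve₂ 4 (λ x y z t → x :+ z := ((x :+ y) :+ (z :+ t)) :+ (y :+ t)) refl (c n) (c (suc n)) _ (c (2 ℕ.+ (n ℕ.+ n))))
        (cong₂ _xor_ (relation n)
          (trans (sym (cong₂ (λ x y → (y ∧ (c n xor c (1 ℕ.+ (n ℕ.+ n)))) xor
            (x ∧ (c (suc n) xor c (2 ℕ.+ (n ℕ.+ n))))) e₀ eₗ)) (boundary n))))

  -- The relations at i + n p and at i differ by (δ i + δ (i + 1)) c n plus a multiple of
  -- c (m + 2n) + c m, and c is not constant.
  jump : ∀ i j m → suc i < p → suc j < p →
    (∀ n → 1 ℕ.+ ((i ℕ.+ n ℕ.* p) ℕ.+ (i ℕ.+ n ℕ.* p)) ≡ j ℕ.+ (m ℕ.+ (n ℕ.+ n)) ℕ.* p) →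
    δ i ≡ δ (suc i) ⊎ (∀ n → c (m ℕ.+ (n ℕ.+ n)) ≡ c n xor c m)
  jump i j m i<p j<p index = decide A A′ refl refl
    where
    A = δ i xor δ (suc i)
    A′ = δ j xor δ (suc j)
    K = (v i xor v (suc i)) xor (v j xor v (suc j))
    x : ℕ → Bool
    x n = c (m ℕ.+ (n ℕ.+ n))
    equation : ∀ n → (K xor (A ∧ c n)) xor (A′ ∧ x n) ≡ true
    equation n = trans (lemma (v i) (v (suc i)) (v j) (v (suc j)) (δ i) (δ (suc i)) (δ j) (δ (suc j)) (c n) (x n))
      (trans (sym (cong₂ _xor_
          (cong₂ _xor_ (automatic n i (ℕₚ.<-trans (ℕₚ.n<1+n i) i<p)) (automatic n (suc i) i<p))
          (cong₂ _xor_ (trans (cong c (index n)) (automatic _ j (ℕₚ.<-trans (ℕₚ.n<1+n j) j<p)))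
            (trans (cong (λ k → c (suc k)) (index n)) (automatic _ (suc j) j<p)))))
        (relation (i ℕ.+ n ℕ.* p)))
      where
      lemma : ∀ v₁ v₂ v₃ v₄ δ₁ δ₂ δ₃ δ₄ y z →
        ((((v₁ xor v₂) xor (v₃ xor v₄)) xor ((δ₁ xor δ₂) ∧ y)) xor ((δ₃ xor δ₄) ∧ z)) ≡
        ((v₁ xor (δ₁ ∧ y)) xor (v₂ xor (δ₂ ∧ y))) xor ((v₃ xor (δ₃ ∧ z)) xor (v₄ xor (δ₄ ∧ z)))
      lemma = solve₂ 10 (λ v₁ v₂ v₃ v₄ δ₁ δ₂ δ₃ δ₄ y z →
        ((((v₁ :+ v₂) :+ (v₃ :+ v₄)) :+ ((δ₁ :+ δ₂) :* y)) :+ ((δ₃ :+ δ₄) :* z)) :=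
        ((v₁ :+ (δ₁ :* y)) :+ (v₂ :+ (δ₂ :* y))) :+ ((v₃ :+ (δ₃ :* z)) :+ (v₄ :+ (δ₄ :* z)))) refl
    difference : ∀ n → (A ∧ c n) xor (A′ ∧ (x n xor c m)) ≡ false
    difference n = trans (lemma K A A′ (c n) (x n) (c m))
      (cong₂ _xor_ (equation n) (trans (cong₂ (λ y z → (K xor (A ∧ y)) xor (A′ ∧ c z)) (sym c₀)
        (sym (ℕₚ.+-identityʳ m))) (equation 0)))
      where
      lemma : ∀ K A A′ y z t → (A ∧ y) xor (A′ ∧ (z xor t)) ≡
        ((K xor (A ∧ y)) xor (A′ ∧ z)) xor ((K xor (A ∧ false)) xor (A′ ∧ t))
      lemma = solve₂ 6 (λ K A A′ y z t → (A :* y) :+ (A′ :* (z :+ t)) :=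
        ((K :+ (A :* y)) :+ (A′ :* z)) :+ ((K :+ (A :* con false)) :+ (A′ :* t))) refl
    decide : ∀ a a′ → A ≡ a → A′ ≡ a′ → δ i ≡ δ (suc i) ⊎ (∀ n → x n ≡ c n xor c m)
    decide false _     e _  = inj₁ (xor-≡ (δ i) (δ (suc i)) e)
    decide true  true  e e′ = inj₂ λ n → trans (solve₂ 3 (λ x y z → x := (y :+ (x :+ z)) :+ (y :+ z)) refl
        (x n) (c n) (c m)) (cong (_xor (c n xor c m))
      (trans (sym (cong₂ (λ a a′ → (a ∧ c n) xor (a′ ∧ (x n xor c m))) e e′)) (difference n)))
    decide true  false e e′ = true≢false c₂ (trans (solve₂ 1 (λ x → x := x :+ con false) refl (c 2))
      (trans (sym (cong₂ (λ a a′ → (a ∧ c 2) xor (a′ ∧ (x 2 xor c m))) e e′)) (difference 2)))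

  -- The doubled pair lies within block 2n if 2i + 2 < p and within block 2n + 1 if 2i + 2 > p. The
  -- second outcome of `jump` again leads to `δ-constant`.
  δ-step : ∀ i → suc i < p → 2 ℕ.+ (i ℕ.+ i) ≢ p → δ i ≡ δ (suc i)
  δ-step i i<p ne with ℕₚ.<-cmp (2 ℕ.+ (i ℕ.+ i)) p
  ... | tri≈ _ eq _ = ⊥-elim (ne eq)
  ... | tri< lt _ _ with jump i (1 ℕ.+ (i ℕ.+ i)) 0 i<p lt (λ n → index i n p)
    where
    index : ∀ i n p → 1 ℕ.+ ((i ℕ.+ n ℕ.* p) ℕ.+ (i ℕ.+ n ℕ.* p)) ≡ (1 ℕ.+ (i ℕ.+ i)) ℕ.+ (n ℕ.+ n) ℕ.* p
    index = ℕSolver.solve-∀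
  ...   | inj₁ eq   = eq
  ...   | inj₂ even = trans (δ-constant true odd i (ℕₚ.<-trans (ℕₚ.n<1+n i) i<p)) (sym (δ-constant true odd (suc i) i<p))
    where
    odd : ∀ n → c (1 ℕ.+ (n ℕ.+ n)) ≡ c n xor true
    odd n = begin
      c (1 ℕ.+ (n ℕ.+ n))
        ≡⟨ solve₂ 3 (λ a b x → x := ((a :+ b) :+ (x :+ (b :+ con false))) :+ a) refl (c n) (c (suc n)) _ ⟩
      ((c n xor c (suc n)) xor (c (1 ℕ.+ (n ℕ.+ n)) xor (c (suc n) xor false))) xor c n
        ≡⟨ cong (λ y → ((c n xor c (suc n)) xor (c (1 ℕ.+ (n ℕ.+ n)) xor y)) xor c n)
             (sym (trans (cong (λ m → c (suc m)) (sym (ℕₚ.+-suc n n))) (trans (even (suc n)) (cong (c (suc n) xor_) c₀)))) ⟩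
      ((c n xor c (suc n)) xor (c (1 ℕ.+ (n ℕ.+ n)) xor c (2 ℕ.+ (n ℕ.+ n)))) xor c n
        ≡⟨ cong (_xor c n) (relation n) ⟩
      true xor c n
        ≡⟨ solve₂ 1 (λ x → con true :+ x := x :+ con true) refl (c n) ⟩
      c n xor true ∎
      where open ≡-Reasoning
  δ-step i i<p ne | tri> _ _ gt with jump i k 1 i<p k<p index
    where
    k = 1 ℕ.+ (i ℕ.+ i) ∸ p
    k+p : k ℕ.+ p ≡ 1 ℕ.+ (i ℕ.+ i)
    k+p = ℕₚ.m∸n+n≡m (ℕₚ.≤-pred gt)
    sum : ∀ i → (2 ℕ.+ i) ℕ.+ (2 ℕ.+ i) ≡ 4 ℕ.+ (i ℕ.+ i)
    sum = ℕSolver.solve-∀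
    k<p : suc k < p
    k<p = ℕₚ.+-cancelʳ-< p (suc k) p (subst (λ m → suc m < p ℕ.+ p) (sym k+p)
      (ℕₚ.≤-trans (ℕₚ.n≤1+n _) (subst (_≤ p ℕ.+ p) (sum i) (ℕₚ.+-mono-≤ i<p i<p))))
    regroup : ∀ i n p → 1 ℕ.+ ((i ℕ.+ n ℕ.* p) ℕ.+ (i ℕ.+ n ℕ.* p)) ≡ (1 ℕ.+ (i ℕ.+ i)) ℕ.+ (n ℕ.+ n) ℕ.* p
    regroup = ℕSolver.solve-∀
    index : ∀ n → 1 ℕ.+ ((i ℕ.+ n ℕ.* p) ℕ.+ (i ℕ.+ n ℕ.* p)) ≡ k ℕ.+ (1 ℕ.+ (n ℕ.+ n)) ℕ.* p
    index n = trans (regroup i n p) (trans (cong (ℕ._+ (n ℕ.+ n) ℕ.* p) (sym k+p)) (ℕₚ.+-assoc k p _))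
  ... | inj₁ eq  = eq
  ... | inj₂ odd = trans (δ-constant (c 1) odd i (ℕₚ.<-trans (ℕₚ.n<1+n i) i<p)) (sym (δ-constant (c 1) odd (suc i) i<p))

  -- No information is available on the step with 2i + 2 = p, so one argues upwards from 0
  -- below the middle, and downwards from p - 1 above it.
  δ-true : ∀ i → i < p → δ i ≡ true
  δ-true i i<p with (i ℕ.+ i) ℕ.<? p
  ... | yes lt = left i lt
    where
    left : ∀ i → i ℕ.+ i < p → δ i ≡ true
    left zero    _  = proj₁ δ-ends
    left (suc i) lt = trans (sym (δ-step i (ℕₚ.≤-<-trans (ℕₚ.m≤m+n (suc i) (suc i)) lt)
        (ℕₚ.<⇒≢ lt′))) (left i (ℕₚ.<-trans (ℕₚ.n<1+n _) (ℕₚ.<-trans (ℕₚ.n<1+n _) lt′)))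
      where
      lt′ : 2 ℕ.+ (i ℕ.+ i) < p
      lt′ = subst (_< p) (cong suc (ℕₚ.+-suc i i)) lt
  ... | no ¬lt = right (l ∸ i) i (ℕₚ.m∸n+n≡m (ℕₚ.≤-pred i<p)) (ℕₚ.≮⇒≥ ¬lt)
    where
    right : ∀ k i → k ℕ.+ i ≡ l → p ≤ i ℕ.+ i → δ i ≡ true
    right zero    i refl _  = proj₂ δ-ends
    right (suc k) i eq   ge = trans (δ-step i (s≤s (subst (suc i ≤_) eq (s≤s (ℕₚ.m≤n+m i k))))
        (λ e → ℕₚ.<⇒≢ (ℕₚ.≤-<-trans ge (ℕₚ.<-trans (ℕₚ.n<1+n _) (ℕₚ.n<1+n _))) (sym e)))
      (right k (suc i) (trans (ℕₚ.+-suc k i) eq) (ℕₚ.≤-trans ge (ℕₚ.+-mono-≤ (ℕₚ.n≤1+n i) (ℕₚ.n≤1+n i))))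

-- The infinite product

ΣFin-single : ∀ n {f : Fin n → ℤ} i → (∀ j → j ≢ i → f j ≡ + 0) → ΣFin n f ≡ f i
ΣFin-single (suc n) {f} fzero    off =
  trans (cong (λ x → f fzero + x) (ΣFin-zero n (λ j → off (fsuc j) λ ()))) (ℤₚ.+-identityʳ _)
ΣFin-single (suc n) {f} (fsuc i) off = trans (cong (_+ ΣFin n (f ∘ fsuc)) (off fzero λ ()))
  (trans (ℤₚ.+-identityˡ _) (ΣFin-single n i (λ j ne → off (fsuc j) (ne ∘ Finₚ.suc-injective))))

sumTo-zero : ∀ n {f : ℕ → ℤ} → (∀ k → k ≤ n → f k ≡ + 0) → sumTo n f ≡ + 0
sumTo-zero zero    off = off 0 z≤n
sumTo-zero (suc n) off = cong₂ _+_ (sumTo-zero n (λ k k≤n → off k (ℕₚ.m≤n⇒m≤1+n k≤n))) (off (suc n) ℕₚ.≤-refl)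

sumTo-single : ∀ n {f : ℕ → ℤ} r → r ≤ n → (∀ k → k ≤ n → k ≢ r → f k ≡ + 0) → sumTo n f ≡ f r
sumTo-single zero    zero z≤n off = refl
sumTo-single (suc n) {f} r r≤n off with ℕₚ.m≤n⇒m<n∨m≡n r≤n
... | inj₁ (s≤s r≤n′) = trans (cong₂ _+_
        (sumTo-single n r r≤n′ (λ k k≤n → off k (ℕₚ.m≤n⇒m≤1+n k≤n)))
        (off (suc n) ℕₚ.≤-refl (λ { refl → ℕₚ.1+n≰n r≤n′ }))) (ℤₚ.+-identityʳ (f r))
... | inj₂ refl = trans (cong (_+ f (suc n)) (sumTo-zero n (λ k k≤n →
        off k (ℕₚ.m≤n⇒m≤1+n k≤n) (ℕₚ.<⇒≢ (s≤s k≤n))))) (ℤₚ.+-identityˡ (f (suc n)))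

if-≡ : ∀ {x y} (a b : ℤ) → x ≡ y → (if x ℕ.≡ᵇ y then a else b) ≡ a
if-≡ {x} {y} a b eq = cong (if_then a else b) (dec-true (x ℕ.≟ y) eq)

if-≢ : ∀ {x y} (a b : ℤ) → x ≢ y → (if x ℕ.≡ᵇ y then a else b) ≡ b
if-≢ {x} {y} a b ne = cong (if_then a else b) (dec-false (x ℕ.≟ y) ne)

PAt-multiple : ∀ {p} (v : Fin p → ℤ) m .{{_ : ℕ.NonZero m}} i → PAt v m (toℕ i ℕ.* m) ≡ v i
PAt-multiple {p} v m i = trans
  (ΣFin-single p i (λ j ne → if-≢ (v j) (+ 0) (λ eq → ne (Finₚ.toℕ-injective (sym (ℕₚ.*-cancelʳ-≡ _ _ m eq))))))
  (if-≡ {toℕ i ℕ.* m} {toℕ i ℕ.* m} (v i) (+ 0) refl)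

PAt-zero : ∀ {p} (v : Fin p → ℤ) m x → (∀ j → x ≢ toℕ {p} j ℕ.* m) → PAt v m x ≡ + 0
PAt-zero {p} v m x ne = ΣFin-zero p (λ j → if-≢ (v j) (+ 0) (ne j))

-- Division with remainder: `a` has degree below `m` and the other factor is a polynomial in zᵐ, so
-- one term survives.
⊛-PAt : ∀ {p} (v : Fin p → ℤ) m .{{_ : ℕ.NonZero m}} (a : Series) → (∀ k → m ≤ k → a k ≡ + 0) →
  ∀ n → (a ⊛ PAt v m) n ≡ a (n % m) * PAt v m (n / m ℕ.* m)
⊛-PAt v m a support n = trans (sumTo-single n (n % m) r≤n off)
  (cong (λ x → a (n % m) * PAt v m x) (trans (cong (_∸ n % m) n≡) (ℕₚ.m+n∸m≡n (n % m) _)))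
  where
  n≡ = m≡m%n+[m/n]*n n m
  r≤n : n % m ≤ n
  r≤n = subst (n % m ≤_) (sym n≡) (ℕₚ.m≤m+n (n % m) _)
  off : ∀ k → k ≤ n → k ≢ n % m → a k * PAt v m (n ∸ k) ≡ + 0
  off k k≤n ne with m ℕ.≤? k
  ... | yes m≤k = trans (cong (_* PAt v m (n ∸ k)) (support k m≤k)) (ℤₚ.*-zeroˡ (PAt v m (n ∸ k)))
  ... | no  m≰k = trans (cong (a k *_) (PAt-zero v m (n ∸ k) λ j eq → ne (begin
      k                          ≡⟨ sym (m<n⇒m%n≡m (ℕₚ.≰⇒> m≰k)) ⟩
      k % m                      ≡⟨ sym ([m+kn]%n≡m%n k (toℕ j) m) ⟩
      (k ℕ.+ toℕ j ℕ.* m) % m    ≡⟨ cong (λ x → (k ℕ.+ x) % m) (sym eq) ⟩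
      (k ℕ.+ (n ∸ k)) % m        ≡⟨ cong (_% m) (ℕₚ.m+[n∸m]≡n k≤n) ⟩
      n % m                      ∎))) (ℤₚ.*-zeroʳ (a k))
    where open ≡-Reasoning

module Product (p : ℕ) (2≤p : 2 ≤ p) (v : Fin p → ℤ) (d : ℕ → ℤ) (d₀ : d 0 ≡ + 1)
  (multiplicative : ∀ n i → d (toℕ i ℕ.+ n ℕ.* p) ≡ d n * v i) where

  instance
    p≢0 : ℕ.NonZero p
    p≢0 = ℕ.>-nonZero (ℕₚ.<-trans (s≤s z≤n) 2≤p)

  -- `multiplicative` splits off the lowest base-p digit, whereas each new factor of the product
  -- governs the highest one; this passes from one to the other.
  leading-digit : ∀ K r → r < p ^ K → ∀ q → d (r ℕ.+ toℕ q ℕ.* p ^ K) ≡ d r * v q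
  leading-digit zero    zero    _ q = trans (cong d (index (toℕ q))) (multiplicative 0 q)
    where
    index : ∀ q → q ℕ.* 1 ≡ q ℕ.+ 0
    index = ℕSolver.solve-∀
  leading-digit zero    (suc r) (s≤s ()) q
  leading-digit (suc K) r       r<    q = begin
    d (r ℕ.+ toℕ q ℕ.* (p ℕ.* p ^ K))
      ≡⟨ cong d (trans (cong (ℕ._+ toℕ q ℕ.* (p ℕ.* p ^ K)) r≡) (index (toℕ i) r′ p (toℕ q) (p ^ K))) ⟩
    d (toℕ i ℕ.+ (r′ ℕ.+ toℕ q ℕ.* p ^ K) ℕ.* p)
      ≡⟨ multiplicative _ i ⟩
    d (r′ ℕ.+ toℕ q ℕ.* p ^ K) * v i
      ≡⟨ cong (_* v i) (leading-digit K r′ (m<n*o⇒m/o<n (subst (r <_) (ℕₚ.*-comm p (p ^ K)) r<)) q) ⟩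
    d r′ * v q * v i
      ≡⟨ swap (d r′) (v q) (v i) ⟩
    d r′ * v i * v q
      ≡⟨ cong (_* v q) (trans (sym (multiplicative r′ i)) (cong d (sym r≡))) ⟩
    d r * v q ∎
    where
    open ≡-Reasoning
    r′ = r / p
    i = fromℕ< (m%n<n r p)
    r≡ : r ≡ toℕ i ℕ.+ r′ ℕ.* p
    r≡ = trans (m≡m%n+[m/n]*n r p) (cong (ℕ._+ r′ ℕ.* p) (sym (Finₚ.toℕ-fromℕ< (m%n<n r p))))
    index : ∀ i r p q m → (i ℕ.+ r ℕ.* p) ℕ.+ q ℕ.* (p ℕ.* m) ≡ i ℕ.+ (r ℕ.+ q ℕ.* m) ℕ.* p
    index = ℕSolver.solve-∀
    swap : ∀ x y z → x * y * z ≡ x * z * y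
    swap = solve-∀

  partialProd-above : ∀ K n → p ^ K ≤ n → partialProd v K n ≡ + 0
  partialProd-above zero    (suc n) _  = refl
  partialProd-above (suc K) n       ge = trans (⊛-PAt v m _ (partialProd-above K) n)
    (trans (cong (partialProd v K (n % m) *_) (PAt-zero v m _ λ j eq → ℕₚ.<⇒≢
      (ℕₚ.<-≤-trans (Finₚ.toℕ<n j) p≤n/m) (sym (ℕₚ.*-cancelʳ-≡ _ _ m eq)))) (ℤₚ.*-zeroʳ (partialProd v K (n % m))))
    where
    m = p ^ K
    instance
      m≢0 : ℕ.NonZero m
      m≢0 = ℕₚ.m^n≢0 p K
    p≤n/m : p ≤ n / m
    p≤n/m = subst (_≤ n / m) (m*n/n≡m p m) (/-monoˡ-≤ m ge)

  partialProd-below : ∀ K n → n < p ^ K → partialProd v K n ≡ d n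
  partialProd-below zero    zero    _        = sym d₀
  partialProd-below zero    (suc n) (s≤s ())
  partialProd-below (suc K) n       lt       = begin
    (partialProd v K ⊛ PAt v m) n
      ≡⟨ ⊛-PAt v m _ (partialProd-above K) n ⟩
    partialProd v K (n % m) * PAt v m (n / m ℕ.* m)
      ≡⟨ cong₂ _*_ (partialProd-below K (n % m) (m%n<n n m))
           (trans (cong (λ x → PAt v m (x ℕ.* m)) (sym q≡)) (PAt-multiple v m q)) ⟩
    d (n % m) * v q
      ≡⟨ sym (leading-digit K (n % m) (m%n<n n m) q) ⟩
    d (n % m ℕ.+ toℕ q ℕ.* m)
      ≡⟨ cong d (trans (cong (λ x → n % m ℕ.+ x ℕ.* m) q≡) (sym (m≡m%n+[m/n]*n n m))) ⟩
    d n ∎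
    where
    open ≡-Reasoning
    m = p ^ K
    instance
      m≢0 : ℕ.NonZero m
      m≢0 = ℕₚ.m^n≢0 p K
    q = fromℕ< (m<n*o⇒m/o<n {n} {p} {m} lt)
    q≡ : toℕ q ≡ n / m
    q≡ = Finₚ.toℕ-fromℕ< (m<n*o⇒m/o<n {n} {p} {m} lt)

  infiniteProduct : EqInfiniteProduct v d
  -- The witness `n` suffices because n ≤ K < p ^ K.
  infiniteProduct n = n , λ K n≤K → partialProd-below K n (ℕₚ.≤-<-trans n≤K (K<p^K K))
    where
    K<p^K : ∀ K → K < p ^ K
    K<p^K zero    = s≤s z≤n
    K<p^K (suc K) = ℕₚ.≤-trans (ℕₚ.+-mono-≤ (ℕₚ.≤-trans (s≤s z≤n) (K<p^K K)) (K<p^K K))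
      (ℕₚ.≤-trans (ℕₚ.≤-reflexive (cong (p ^ K ℕ.+_) (sym (ℕₚ.+-identityʳ (p ^ K))))) (ℕₚ.*-monoˡ-≤ (p ^ K) 2≤p))

-- Blocks of the fixed point

nth-++ˡ : ∀ {A : Set} {n} (u : Fin n → A) ys i → nth (tabulate u ++ ys) (toℕ i) ≡ just (u i)
nth-++ˡ u ys fzero    = refl
nth-++ˡ u ys (fsuc i) = nth-++ˡ (u ∘ fsuc) ys i

nth-++ʳ : ∀ {A : Set} {n} (u : Fin n → A) ys m → nth (tabulate u ++ ys) (n ℕ.+ m) ≡ nth ys m
nth-++ʳ {n = zero}  u ys m = refl
nth-++ʳ {n = suc n} u ys m = nth-++ʳ (u ∘ fsuc) ys m

σ-choice : ∀ {p} (v w : Fin p → ℤ) x → σ v w x ≡ tabulate v ⊎ σ v w x ≡ tabulate w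
σ-choice v w x with x ℤ.≟ + 1
... | yes _ = inj₁ refl
... | no  _ = inj₂ refl

-- Both images have length p, so block `n` starts at n p whatever letters precede it.
nth-σ* : ∀ {p} (v w : Fin p → ℤ) xs n x (u : Fin p → ℤ) → nth xs n ≡ just x → σ v w x ≡ tabulate u →
  ∀ i → nth (σ* v w xs) (toℕ i ℕ.+ n ℕ.* p) ≡ just (u i)
nth-σ* v w (y ∷ xs) zero x u eq σ≡ i with just-injective eq
... | refl rewrite σ≡ | ℕₚ.+-identityʳ (toℕ i) = nth-++ˡ u (σ* v w xs) i
nth-σ* {p} v w (y ∷ xs) (suc n) x u eq σ≡ i = trans (cong (nth (σ v w y ++ σ* v w xs)) (index (toℕ i) p (n ℕ.* p)))
  (trans (drop (σ-choice v w y)) (nth-σ* v w xs n x u eq σ≡ i))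
  where
  index : ∀ i p m → i ℕ.+ (p ℕ.+ m) ≡ p ℕ.+ (i ℕ.+ m)
  index = ℕSolver.solve-∀
  m = toℕ i ℕ.+ n ℕ.* p
  drop : σ v w y ≡ tabulate v ⊎ σ v w y ≡ tabulate w → nth (σ v w y ++ σ* v w xs) (p ℕ.+ m) ≡ nth (σ* v w xs) m
  drop (inj₁ e) rewrite e = nth-++ʳ v (σ* v w xs) m
  drop (inj₂ e) rewrite e = nth-++ʳ w (σ* v w xs) m

limit-block : ∀ {p} (v w : Fin p → ℤ) d → IsLimitFixedPoint v w d → ∀ n (u : Fin p → ℤ) →
  σ v w (d n) ≡ tabulate u → ∀ i → d (toℕ i ℕ.+ n ℕ.* p) ≡ u i
limit-block {p} v w d lim n u σ≡ i with lim n | lim (toℕ i ℕ.+ n ℕ.* p)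
... | N , stable | M , stable′ = just-injective (trans
  -- A stage beyond both bounds is compared with its own image under the substitution.
  (sym (stable′ (suc (N ℕ.⊔ M)) (ℕₚ.m≤n⇒m≤1+n (ℕₚ.m≤n⊔m N M))))
  (nth-σ* v w (σIter v w (N ℕ.⊔ M)) n (d n) u (stable (N ℕ.⊔ M) (ℕₚ.m≤m⊔n N M)) σ≡ i))

limit-head : ∀ {l} (v w : Fin (suc l) → ℤ) d → v fzero ≡ + 1 → IsLimitFixedPoint v w d → d 0 ≡ + 1
limit-head v w d v₀ lim with lim 0
... | N , stable = just-injective (trans (sym (stable N ℕₚ.≤-refl)) (head N))
  where
  head : ∀ n → nth (σIter v w n) 0 ≡ just (+ 1)
  head zero    = refl
  head (suc n) = trans (nth-σ* v w (σIter v w n) 0 (+ 1) v (head n) refl fzero) (cong just v₀)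

bit : ℤ → Bool
bit (+ _)    = false
bit -[1+ _ ] = true

sign-bit : ∀ {x} → IsPM x → x ≡ sign (bit x)
sign-bit (inj₁ refl) = refl
sign-bit (inj₂ refl) = refl

module Limit {l} (v w : Fin (suc l) → ℤ) (pm-v : ∀ i → IsPM (v i)) (pm-w : ∀ i → IsPM (w i))
  (v₀ : v fzero ≡ + 1) (d : ℕ → ℤ) (lim : IsLimitFixedPoint v w d) (apw : Apwenian d) where

  private
    p = suc l

  -- Every position lies in a block, and each block is the word v or w, since every letter other
  -- than 1 is sent to w.
  pm-d : ∀ n → IsPM (d n)
  pm-d n = subst (λ m → IsPM (d m)) (sym n≡) (pm (σ-choice v w (d (n / p))))
    where
    i = fromℕ< (m%n<n n p)
    n≡ : n ≡ toℕ i ℕ.+ (n / p) ℕ.* p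
    n≡ = trans (m≡m%n+[m/n]*n n p) (cong (ℕ._+ (n / p) ℕ.* p) (sym (Finₚ.toℕ-fromℕ< (m%n<n n p))))
    pm : σ v w (d (n / p)) ≡ tabulate v ⊎ σ v w (d (n / p)) ≡ tabulate w → IsPM (d (toℕ i ℕ.+ (n / p) ℕ.* p))
    pm (inj₁ e) = subst IsPM (sym (limit-block v w d lim (n / p) v e i)) (pm-v i)
    pm (inj₂ e) = subst IsPM (sym (limit-block v w d lim (n / p) w e i)) (pm-w i)

  d₀ : d 0 ≡ + 1
  d₀ = limit-head v w d v₀ lim

  c : ℕ → Bool
  c n = bit (d n)

  -- Indices in ℕ can be doubled and halved freely; the default lies outside the range `i < p` of
  -- the block formula.
  extend : (Fin p → Bool) → ℕ → Bool
  extend u i with i ℕ.<? p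
  ... | yes i<p = u (fromℕ< i<p)
  ... | no  _   = false

  extend-< : ∀ u i (i<p : i < p) → extend u i ≡ u (fromℕ< i<p)
  extend-< u i i<p with i ℕ.<? p
  ... | yes _   = refl
  ... | no  i≮p = ⊥-elim (i≮p i<p)

  δ : Fin p → Bool
  δ i = bit (v i) xor bit (w i)

  block : ∀ n → d n ≡ + 1 × (∀ i → d (toℕ i ℕ.+ n ℕ.* p) ≡ v i) ⊎
                d n ≡ - (+ 1) × (∀ i → d (toℕ i ℕ.+ n ℕ.* p) ≡ w i)
  block n with pm-d n
  ... | inj₁ e = inj₁ (e , limit-block v w d lim n v (cong (σ v w) e))
  ... | inj₂ e = inj₂ (e , limit-block v w d lim n w (cong (σ v w) e))

  automatic : ∀ n i → c (toℕ i ℕ.+ n ℕ.* p) ≡ bit (v i) xor (δ i ∧ c n)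
  automatic n i with block n
  ... | inj₁ (dn , db) = trans (cong bit (db i)) (trans
        (solve₂ 2 (λ x y → x := x :+ (x :+ y) :* con false) refl (bit (v i)) (bit (w i)))
        (cong (λ x → bit (v i) xor (δ i ∧ bit x)) (sym dn)))
  ... | inj₂ (dn , db) = trans (cong bit (db i)) (trans
        (solve₂ 2 (λ x y → y := x :+ (x :+ y) :* con true) refl (bit (v i)) (bit (w i)))
        (cong (λ x → bit (v i) xor (δ i ∧ bit x)) (sym dn)))

  open Automatic l c (extend (bit ∘ v)) (extend δ) (cong bit d₀)
    (λ n i i<p → trans (cong (λ m → c (m ℕ.+ n ℕ.* p)) (sym (Finₚ.toℕ-fromℕ< i<p)))
      (trans (automatic n (fromℕ< i<p)) (sym (cong₂ (λ x y → x xor (y ∧ c n))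
        (extend-< (bit ∘ v) i i<p) (extend-< δ i i<p)))))
    (apwenian-relation c d (λ n → sign-bit (pm-d n)) apw)
    using (δ-true)

  w≡-v : ∀ i → w i ≡ - v i
  w≡-v i = opposite (pm-v i) (pm-w i) (trans (cong δ (sym (Finₚ.fromℕ<-toℕ i (Finₚ.toℕ<n i))))
    (trans (sym (extend-< δ (toℕ i) (Finₚ.toℕ<n i))) (δ-true (toℕ i) (Finₚ.toℕ<n i))))
    where
    opposite : ∀ {x y} → IsPM x → IsPM y → bit x xor bit y ≡ true → y ≡ - x
    opposite (inj₁ refl) (inj₁ refl) ()
    opposite (inj₁ refl) (inj₂ refl) _ = refl
    opposite (inj₂ refl) (inj₁ refl) _ = refl
    opposite (inj₂ refl) (inj₂ refl) ()

  multiplicative : ∀ n i → d (toℕ i ℕ.+ n ℕ.* p) ≡ d n * v i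
  multiplicative n i with block n
  ... | inj₁ (dn , db) = trans (db i) (sym (trans (cong (_* v i) dn) (ℤₚ.*-identityˡ (v i))))
  ... | inj₂ (dn , db) = trans (db i) (trans (w≡-v i) (sym (trans (cong (_* v i) dn) (ℤₚ.-1*i≡-i (v i)))))

theorem1p2 : (p : ℕ) → 2 ≤ p → (v w : Fin p → ℤ)
    → (∀ i → IsPM (v i)) → (∀ i → IsPM (w i))
    → (∀ i → toℕ i ≡ 0 → v i ≡ + 1)
    → (d : ℕ → ℤ) → IsLimitFixedPoint v w d
    → Apwenian d
    → EqInfiniteProduct v d
theorem1p2 (suc l) 2≤p v w pm-v pm-w v₀ d lim apw =
  Product.infiniteProduct (suc l) 2≤p v d d₀ multiplicative
  where
  open Limit v w pm-v pm-w (v₀ fzero refl) d lim apw
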